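{- Let $3 \leq s \leq t$ be integers. There is a constant $c=c(s,t)$ such that for all trees $T_1$ and $T_2$ on $s$ and $t$ vertices respectively and all integers $n\ge s+t$, $$\mathrm{ex}(n,K_{s,t}^-)/2 \leq \mathrm{ar}^{\star}(n,T_1 + T_2) \leq c\, n^{2-1/s}.$$
   Context: The join $G_1+G_2$ of two graphs is obtained by taking vertex-disjoint copies of $G_1$ and $G_2$ and adding all edges between them. $K_{s,t}^-$ is the graph obtained from the complete bipartite graph $K_{s,t}$ by removing one edge. $\mathrm{ex}(n,H)$ is the maximum number of edges in an $n$-vertex graph with no copy of $H$ as a (not necessarily induced) subgraph. A star-colouring of a graph $G$ is an edge-colouring of $G$ in which every colour class is a star (a copy of $K_{1,m}$ with $m\ge 1$, a single edge being allowed). An edge-coloured graph is rainbow if all its edges have different colours. For a graph $H$, $\mathrm{ar}^{\star}(n,H)$ denotes the maximum number of colours in a star-colouring of $K_n$ without a rainbow copy of $H$. -}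

module Defs where

open import Data.Bool.Base using (Bool; true; false; T; not; if_then_else_)
open import Data.Bool.Properties using (T?) renaming (_≟_ to _≟ᵇ_)
open import Data.Fin.Base using (Fin; zero; suc; _<_; inject₁; fromℕ; splitAt; combine)
open import Data.Fin.Properties
  using (_≟_; _<?_; any?; all?; combine-injective; injective⇒≤)
open import Data.List.Base using (List; []; _∷_; length; filter; cartesianProduct; allFin; map)
open import Data.List.Properties
  using (length-filter; filter-≐; length-++; length-map; length-tabulate)
open import Data.Nat.Base as ℕ using (ℕ; zero; suc; _+_; _*_; _≤_; z≤n)
import Data.Nat.Properties as ℕ
open import Data.Product using (Σ; ∃; ∃₂; _×_; _,_; proj₁; proj₂)
open import Data.Sum.Base using (_⊎_; inj₁; inj₂)
import Data.Vec.Functional as Vector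
open import Function.Base using (_∘_)
open import Function.Definitions using (Injective)
open import Level using (0ℓ)
open import Relation.Binary.Construct.Closure.ReflexiveTransitive using (Star)
open import Relation.Binary.Core using (Rel)
open import Relation.Binary.PropositionalEquality
open import Relation.Nullary
  using (¬_; Dec; yes; no; does; contradiction; ¬?; _×-dec_; _⊎-dec_; _→-dec_)
open import Relation.Nullary.Decidable using (map′)

record Graph (n : ℕ) : Set where
  constructor mkGraph
  field
    adj        : Fin n → Fin n → Bool
    adj-sym    : ∀ i j → adj i j ≡ adj j i
    adj-irrefl : ∀ i → adj i i ≡ false

  Adj : Rel (Fin n) 0ℓ
  Adj i j = T (adj i j)

open Graph public

-- An edge is counted once, through its increasing orientation.
IncreasingEdge : ∀ {n} → Graph n → Fin n × Fin n → Set
IncreasingEdge G (i , j) = i < j × Adj G i j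

increasingEdge? : ∀ {n} (G : Graph n) (e : Fin n × Fin n) → Dec (IncreasingEdge G e)
increasingEdge? G (i , j) = (i <? j) ×-dec T? (adj G i j)

edges : ∀ {n} → Graph n → ℕ
edges {n} G = length (filter (increasingEdge? G) (cartesianProduct (allFin n) (allFin n)))

-- H ⊑ G: G has a (not necessarily induced) subgraph isomorphic to H.
_⊑_ : ∀ {h n} → Graph h → Graph n → Set
_⊑_ {h} {n} H G =
  Σ (Fin h → Fin n) λ f →
    Injective _≡_ _≡_ f × (∀ u v → Adj H u v → Adj G (f u) (f v))

Connected : ∀ {n} → Graph n → Set
Connected G = ∀ i j → Star (Adj G) i j

record Cycle {n} (G : Graph n) : Set where
  field
    k         : ℕ
    vertex    : Fin (3 + k) → Fin n
    injective : Injective _≡_ _≡_ vertex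
    step      : ∀ (i : Fin (2 + k)) → Adj G (vertex (inject₁ i)) (vertex (suc i))
    closing   : Adj G (vertex (fromℕ (2 + k))) (vertex zero)

-- The graph on no vertices also satisfies this; it plays no role for trees of
-- a prescribed positive order.
IsTree : ∀ {n} → Graph n → Set
IsTree G = Connected G × ¬ Cycle G

-- In both graphs on Fin (s + t) below, the first s vertices form one side and
-- the last t vertices the other.

module _ {s t : ℕ} (G₁ : Graph s) (G₂ : Graph t) where

  joinAdj : Fin s ⊎ Fin t → Fin s ⊎ Fin t → Bool
  joinAdj (inj₁ i) (inj₁ j) = adj G₁ i j
  joinAdj (inj₂ i) (inj₂ j) = adj G₂ i j
  joinAdj (inj₁ _) (inj₂ _) = true
  joinAdj (inj₂ _) (inj₁ _) = true

  joinAdj-sym : ∀ x y → joinAdj x y ≡ joinAdj y x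
  joinAdj-sym (inj₁ i) (inj₁ j) = adj-sym G₁ i j
  joinAdj-sym (inj₂ i) (inj₂ j) = adj-sym G₂ i j
  joinAdj-sym (inj₁ _) (inj₂ _) = refl
  joinAdj-sym (inj₂ _) (inj₁ _) = refl

  joinAdj-irrefl : ∀ x → joinAdj x x ≡ false
  joinAdj-irrefl (inj₁ i) = adj-irrefl G₁ i
  joinAdj-irrefl (inj₂ i) = adj-irrefl G₂ i

  join : Graph (s + t)
  join = mkGraph (λ i j → joinAdj (splitAt s i) (splitAt s j))
                 (λ i j → joinAdj-sym (splitAt s i) (splitAt s j))
                 (λ i → joinAdj-irrefl (splitAt s i))

module _ (s t : ℕ) where

  -- The missing edge joins the first vertices of the two sides; the choice
  -- is immaterial up to isomorphism.
  missing : Fin s → Fin t → Bool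
  missing zero    zero    = true
  missing zero    (suc _) = false
  missing (suc _) _       = false

  K⁻Adj : Fin s ⊎ Fin t → Fin s ⊎ Fin t → Bool
  K⁻Adj (inj₁ i) (inj₂ j) = not (missing i j)
  K⁻Adj (inj₂ j) (inj₁ i) = not (missing i j)
  K⁻Adj (inj₁ _) (inj₁ _) = false
  K⁻Adj (inj₂ _) (inj₂ _) = false

  K⁻Adj-sym : ∀ x y → K⁻Adj x y ≡ K⁻Adj y x
  K⁻Adj-sym (inj₁ _) (inj₂ _) = refl
  K⁻Adj-sym (inj₂ _) (inj₁ _) = refl
  K⁻Adj-sym (inj₁ _) (inj₁ _) = refl
  K⁻Adj-sym (inj₂ _) (inj₂ _) = refl

  K⁻Adj-irrefl : ∀ x → K⁻Adj x x ≡ false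
  K⁻Adj-irrefl (inj₁ _) = refl
  K⁻Adj-irrefl (inj₂ _) = refl

  K⁻ : Graph (s + t)
  K⁻ = mkGraph (λ i j → K⁻Adj (splitAt s i) (splitAt s j))
               (λ i j → K⁻Adj-sym (splitAt s i) (splitAt s j))
               (λ i → K⁻Adj-irrefl (splitAt s i))

-- The value `colour i j` is the colour of the edge ij; the values on the
-- diagonal carry no meaning and no field looks at them.  All k colours are
-- used, and for each colour c there is a vertex contained in every edge of
-- colour c, so each colour class is a star with at least one edge.
record StarColouring (n k : ℕ) : Set where
  constructor mkStarColouring
  field
    colour     : Fin n → Fin n → Fin k
    colour-sym : ∀ i j → i ≢ j → colour i j ≡ colour j i
    used       : ∀ c → ∃₂ λ i j → i ≢ j × colour i j ≡ c
    star       : ∀ c → ∃ λ v → ∀ i j → i ≢ j → colour i j ≡ c → i ≡ v ⊎ j ≡ v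

open StarColouring public

SameEdge : ∀ {h} → Fin h → Fin h → Fin h → Fin h → Set
SameEdge u v x y = (u ≡ x × v ≡ y) ⊎ (u ≡ y × v ≡ x)

-- In a complete graph every injection of the vertices of H gives a copy of H.
RainbowCopy : ∀ {n k h} → StarColouring n k → Graph h → Set
RainbowCopy {n} {k} {h} χ H =
  Σ (Fin h → Fin n) λ f →
    Injective _≡_ _≡_ f ×
    (∀ u v x y → Adj H u v → Adj H x y →
      colour χ (f u) (f v) ≡ colour χ (f x) (f y) → SameEdge u v x y)

-- The largest m with 1 ≤ m ≤ b and P m, or 0 if there is none.
largest : {P : ℕ → Set} → (∀ m → Dec (P m)) → ℕ → ℕ
largest P? zero    = 0
largest P? (suc b) = if does (P? (suc b)) then suc b else largest P? b

IsMaximum : (ℕ → Set) → ℕ → Set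
IsMaximum P m = P m × (∀ k → P k → k ≤ m)

module _ {P : ℕ → Set} (P? : ∀ m → Dec (P m)) where

  largest-sat : ∀ b {m} → m ≤ b → P m → P (largest P? b)
  largest-sat zero    z≤n Pm = Pm
  largest-sat (suc b) m≤b Pm with P? (suc b)
  ... | yes Pb = Pb
  ... | no ¬Pb with ℕ.m≤n⇒m<n∨m≡n m≤b
  ...   | inj₁ m<b  = largest-sat b (ℕ.s≤s⁻¹ m<b) Pm
  ...   | inj₂ refl = contradiction Pm ¬Pb

  largest-ub : ∀ b {m} → m ≤ b → P m → m ≤ largest P? b
  largest-ub zero    z≤n Pm = z≤n
  largest-ub (suc b) m≤b Pm with P? (suc b)
  ... | yes Pb = m≤b
  ... | no ¬Pb with ℕ.m≤n⇒m<n∨m≡n m≤b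
  ...   | inj₁ m<b  = largest-ub b (ℕ.s≤s⁻¹ m<b) Pm
  ...   | inj₂ refl = contradiction Pm ¬Pb

  largest-isMaximum : ∀ b → (∀ m → P m → m ≤ b) → ∃ P → IsMaximum P (largest P? b)
  largest-isMaximum b bound (m , Pm) =
    largest-sat b (bound m Pm) Pm , λ k Pk → largest-ub b (bound k Pk) Pk

-- Without function extensionality, a property of functions can be searched for
-- only if it is stable under pointwise equality.

Searchable : (A : Set) → Rel A 0ℓ → Set₁
Searchable A _≈_ =
  {P : A → Set} → (∀ {x y} → x ≈ y → P x → P y) → (∀ x → Dec (P x)) → Dec (∃ P)

Pointwise : ∀ {n} {A : Set} → Rel A 0ℓ → Rel (Fin n → A) 0ℓ
Pointwise _≈_ f g = ∀ i → f i ≈ g i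

search-Fin : ∀ {n} → Searchable (Fin n) _≡_
search-Fin _ P? = any? P?

search-Bool : Searchable Bool _≡_
search-Bool {P} _ P? = map′ to from (P? true ⊎-dec P? false)
  where
  to : P true ⊎ P false → ∃ P
  to (inj₁ p) = true  , p
  to (inj₂ p) = false , p
  from : ∃ P → P true ⊎ P false
  from (true  , p) = inj₁ p
  from (false , p) = inj₂ p

search-→ : ∀ {A : Set} {_≈_ : Rel A 0ℓ} → (∀ {x} → x ≈ x) →
           Searchable A _≈_ → ∀ n → Searchable (Fin n → A) (Pointwise _≈_)
search-→ rfl sA zero resp P? =
  map′ (λ p → _ , p) (λ (f , p) → resp (λ ()) p) (P? (λ ()))
search-→ {A} {_≈_} rfl sA (suc n) {P} resp P? =
  map′ (λ (a , f , p) → (a Vector.∷ f) , p)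
       (λ (f , p) → f zero , f ∘ suc , resp (λ { zero → rfl ; (suc _) → rfl }) p)
       (sA respHead
           (λ a → search-→ rfl sA n (λ e → resp (λ { zero → rfl ; (suc i) → e i }))
                           (λ f → P? (a Vector.∷ f))))
  where
  respHead : ∀ {a b} → a ≈ b → ∃ (λ f → P (a Vector.∷ f)) → ∃ (λ f → P (b Vector.∷ f))
  respHead e (f , p) = f , resp (λ { zero → e ; (suc _) → rfl }) p

search-→₂ : ∀ {A : Set} → Searchable A _≡_ → ∀ m n →
            Searchable (Fin m → Fin n → A) (λ f g → ∀ i j → f i j ≡ g i j)
search-→₂ sA m n = search-→ (λ _ → refl) (search-→ refl sA n) m

injective? : ∀ {m n} (f : Fin m → Fin n) → Dec (Injective _≡_ _≡_ f)
injective? f =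
  map′ (λ h {i} {j} → h i j) (λ h i j → h {i} {j})
       (all? λ i → all? λ j → (f i ≟ f j) →-dec (i ≟ j))

injective-resp : ∀ {m n} {f g : Fin m → Fin n} → f ≗ g →
                 Injective _≡_ _≡_ f → Injective _≡_ _≡_ g
injective-resp e inj {x} {y} eq = inj (trans (e x) (trans eq (sym (e y))))

sameEdge? : ∀ {h} (u v x y : Fin h) → Dec (SameEdge u v x y)
sameEdge? u v x y = ((u ≟ x) ×-dec (v ≟ y)) ⊎-dec ((u ≟ y) ×-dec (v ≟ x))

_⊑?_ : ∀ {h n} (H : Graph h) (G : Graph n) → Dec (H ⊑ G)
H ⊑? G = search-→ refl search-Fin _
  (λ e (inj , hom) → injective-resp e inj ,
     λ u v uv → subst T (cong₂ (adj G) (e u) (e v)) (hom u v uv))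
  (λ f → injective? f ×-dec
     (all? λ u → all? λ v → T? (adj H u v) →-dec T? (adj G (f u) (f v))))

rainbowCopy? : ∀ {n k h} (χ : StarColouring n k) (H : Graph h) → Dec (RainbowCopy χ H)
rainbowCopy? χ H = search-→ refl search-Fin _
  (λ e (inj , rb) → injective-resp e inj ,
     λ u v x y uv xy eq → rb u v x y uv xy
       (trans (cong₂ (colour χ) (e u) (e v))
         (trans eq (sym (cong₂ (colour χ) (e x) (e y))))))
  (λ f → injective? f ×-dec
     (all? λ u → all? λ v → all? λ x → all? λ y →
        T? (adj H u v) →-dec (T? (adj H x y) →-dec
          ((colour χ (f u) (f v) ≟ colour χ (f x) (f y)) →-dec sameEdge? u v x y))))

search-Graph : ∀ n → Searchable (Graph n) (λ G G′ → ∀ i j → adj G i j ≡ adj G′ i j)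
search-Graph n {P} resp P? =
  map′ (λ (a , s , i , p) → mkGraph a s i , p)
       (λ (G , p) → adj G , adj-sym G , adj-irrefl G , p)
       (search-→₂ search-Bool n n respQ Q?)
  where
  Q : (Fin n → Fin n → Bool) → Set
  Q a = Σ (∀ i j → a i j ≡ a j i) λ s → Σ (∀ i → a i i ≡ false) λ r → P (mkGraph a s r)

  respQ : ∀ {a b} → (∀ i j → a i j ≡ b i j) → Q a → Q b
  respQ e (s , r , p) =
    (λ i j → trans (sym (e i j)) (trans (s i j) (e j i))) ,
    (λ i → trans (sym (e i i)) (r i)) , resp e p

  Q? : ∀ a → Dec (Q a)
  Q? a with all? (λ i → all? λ j → a i j ≟ᵇ a j i) | all? (λ i → a i i ≟ᵇ false)
  ... | no ¬s | _     = no (¬s ∘ proj₁)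
  ... | yes _ | no ¬r = no (¬r ∘ proj₁ ∘ proj₂)
  ... | yes s | yes r = map′ (λ p → s , r , p) (λ (s′ , r′ , p) → resp (λ _ _ → refl) p)
                             (P? (mkGraph a s r))

search-StarColouring : ∀ n k →
  Searchable (StarColouring n k) (λ χ χ′ → ∀ i j → colour χ i j ≡ colour χ′ i j)
search-StarColouring n k {P} resp P? =
  map′ (λ (c , s , u , st , p) → mkStarColouring c s u st , p)
       (λ (χ , p) → colour χ , colour-sym χ , used χ , star χ , p)
       (search-→₂ search-Fin n n respQ Q?)
  where
  module _ (c : Fin n → Fin n → Fin k) where
    Sym Used Stars : Set
    Sym   = ∀ i j → i ≢ j → c i j ≡ c j i
    Used  = ∀ d → ∃₂ λ i j → i ≢ j × c i j ≡ d
    Stars = ∀ d → ∃ λ v → ∀ i j → i ≢ j → c i j ≡ d → i ≡ v ⊎ j ≡ v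

  Q : (Fin n → Fin n → Fin k) → Set
  Q c = Σ (Sym c) λ s → Σ (Used c) λ u → Σ (Stars c) λ st → P (mkStarColouring c s u st)

  respQ : ∀ {c d} → (∀ i j → c i j ≡ d i j) → Q c → Q d
  respQ e (s , u , st , p) =
    (λ i j i≢j → trans (sym (e i j)) (trans (s i j i≢j) (e j i))) ,
    (λ x → let i , j , i≢j , eq = u x in i , j , i≢j , trans (sym (e i j)) eq) ,
    (λ x → let v , h = st x in v , λ i j i≢j eq → h i j i≢j (trans (e i j) eq)) ,
    resp e p

  Q? : ∀ c → Dec (Q c)
  Q? c with all? (λ i → all? λ j → ¬? (i ≟ j) →-dec (c i j ≟ c j i))
          | all? (λ d → any? λ i → any? λ j → ¬? (i ≟ j) ×-dec (c i j ≟ d))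
          | all? (λ d → any? λ v → all? λ i → all? λ j →
                    ¬? (i ≟ j) →-dec ((c i j ≟ d) →-dec ((i ≟ v) ⊎-dec (j ≟ v))))
  ... | no ¬s | _     | _      = no (¬s ∘ proj₁)
  ... | yes _ | no ¬u | _      = no (¬u ∘ proj₁ ∘ proj₂)
  ... | yes _ | yes _ | no ¬st = no (¬st ∘ proj₁ ∘ proj₂ ∘ proj₂)
  ... | yes s | yes u | yes st =
    map′ (λ p → s , u , st , p) (λ (_ , _ , _ , p) → resp (λ _ _ → refl) p)
         (P? (mkStarColouring c s u st))

-- When no H-free graph (respectively no star-colouring
-- without a rainbow copy of H) exists at all, the value is 0; otherwise
-- ex-isMaximum and ar⋆-isMaximum apply.

module _ (n : ℕ) {h : ℕ} (H : Graph h) where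

  HFreeWithEdges : ℕ → Set
  HFreeWithEdges m = Σ (Graph n) λ G → edges G ≡ m × ¬ (H ⊑ G)

  RainbowFreeWithColours : ℕ → Set
  RainbowFreeWithColours k = Σ (StarColouring n k) λ χ → ¬ RainbowCopy χ H

  hFreeWithEdges? : ∀ m → Dec (HFreeWithEdges m)
  hFreeWithEdges? m = search-Graph n
    (λ {G} {G′} e (eq , free) →
       trans (cong length (filter-≐ (increasingEdge? G′) (increasingEdge? G)
               ((λ {(i , j)} (lt , a) → lt , subst T (sym (e i j)) a) ,
                (λ {(i , j)} (lt , a) → lt , subst T (e i j) a))
               (cartesianProduct (allFin n) (allFin n)))) eq ,
       λ (f , inj , hom) → free (f , inj , λ u v uv → subst T (sym (e _ _)) (hom u v uv)))
    (λ G → (edges G ℕ.≟ m) ×-dec ¬? (H ⊑? G))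

  rainbowFreeWithColours? : ∀ k → Dec (RainbowFreeWithColours k)
  rainbowFreeWithColours? k = search-StarColouring n k
    (λ e free (f , inj , rb) → free (f , inj , λ u v x y uv xy eq →
       rb u v x y uv xy (trans (sym (e _ _)) (trans eq (e _ _)))))
    (λ χ → ¬? (rainbowCopy? χ H))

  -- n * n bounds the number of edges of any graph on n vertices, and
  -- the number of colours of any colouring.
  ex : ℕ
  ex = largest hFreeWithEdges? (n * n)

  ar⋆ : ℕ
  ar⋆ = largest rainbowFreeWithColours? (n * n)

  private
    length-pairs : ∀ {A B : Set} (xs : List A) (ys : List B) →
                   length (cartesianProduct xs ys) ≡ length xs * length ys
    length-pairs []       ys = refl
    length-pairs (x ∷ xs) ys =
      trans (length-++ (map (x ,_) ys)) (cong₂ _+_ (length-map (x ,_) ys) (length-pairs xs ys))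

    length-allFin : length (allFin n) ≡ n
    length-allFin = length-tabulate _

    edges-bound : ∀ m → HFreeWithEdges m → m ≤ n * n
    edges-bound m (G , refl , _) = subst (edges G ≤_)
      (trans (length-pairs (allFin n) (allFin n)) (cong₂ _*_ length-allFin length-allFin))
      (length-filter _ (cartesianProduct (allFin n) (allFin n)))

    colours-bound : ∀ k → RainbowFreeWithColours k → k ≤ n * n
    colours-bound k (χ , _) = injective⇒≤ {f = code} code-injective
      where
      code : Fin k → Fin (n * n)
      code c = let i , j , _ = used χ c in combine i j
      code-injective : Injective _≡_ _≡_ code
      code-injective {c} {d} eq =
        let i , j , _ , p = used χ c
            x , y , _ , q = used χ d
            i≡x , j≡y = combine-injective i j x y eq
        in trans (sym p) (trans (cong₂ (colour χ) i≡x j≡y) q)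

  ex-isMaximum : ∃ HFreeWithEdges → IsMaximum HFreeWithEdges ex
  ex-isMaximum = largest-isMaximum hFreeWithEdges? (n * n) edges-bound

  ar⋆-isMaximum : ∃ RainbowFreeWithColours → IsMaximum RainbowFreeWithColours ar⋆
  ar⋆-isMaximum = largest-isMaximum rainbowFreeWithColours? (n * n) colours-bound

-- Upper bound.  Orient each edge from the centre of its colour; edges at a vertex
-- coming in then have different colours, so a tree all of whose edges point towards
-- the root is rainbow.  Choosing one arc "centre → tip" for each of the k colours, and
-- counting pairs of a transitive s-tuple and a common out-neighbour of it along chosen
-- arcs, the Kővári–Sós–Turán argument yields, for large k, a transitive s-tuple with
-- so many common out-neighbours that some of them form a transitive t-tuple.  The
-- tuples host T₁ and T₂, and the colours of the cross edges are centred in the first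
-- tuple, so they can only clash with few colours of T₁.
--
-- Lower bound.  Keep a bipartite subgraph C with half of the edges of a K⁻-free graph,
-- give its edges private colours, and colour any other pair by its smaller vertex.
-- The edges of a rainbow copy outside C form a forest.  It connects the vertices of the
-- copy within each side of C, so it has at most one edge across, and C contains K⁻.
module Submission where

open import Defs
open import Data.Nat using (ℕ; _+_; _*_; _∸_; _^_; _≤_)
open import Data.Product using (_×_; ∃)

open import Data.Bool.Base using (Bool; true; false; T; not; if_then_else_; _∧_; _xor_)
open import Data.Bool.Properties
  using (T?; T-∧; ∧-identityʳ; ∧-zeroʳ; xor-comm; xor-same) renaming (_≟_ to _≟ᵇ_)
open import Data.Empty using (⊥; ⊥-elim)
open import Data.Fin.Base as Fin
  using (Fin; zero; suc; toℕ; fromℕ; inject₁; inject≤; punchIn; punchOut; combine; remQuot; splitAt)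
open import Data.Fin.Permutation.Components using (transpose; transpose-inverse)
open import Data.Fin.Properties
  using ( _≟_; any?; all?; injective⇒≤; suc-injective; toℕ-injective; toℕ-inject₁; toℕ-inject≤
        ; toℕ-fromℕ; toℕ<n; inject≤-injective; inject₁-injective; fromℕ≢inject₁
        ; punchIn-injective; punchInᵢ≢i; punchIn-punchOut; splitAt-join; join-splitAt
        ; remQuot-combine; combine-injective)
  renaming ( _<?_ to _<ᶠ?_; <-cmp to <ᶠ-cmp; <-irrefl to <ᶠ-irrefl; <-asym to <ᶠ-asym
           ; <-trans to <ᶠ-trans; ≤-antisym to ≤ᶠ-antisym)
open import Data.List.Base
  using (List; _∷_; length; filter; cartesianProduct; allFin; map; tabulate; lookup; _++_)
open import Data.List.Membership.Propositional using (_∈_)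
open import Data.List.Membership.Propositional.Properties
  using (∈-filter⁺; ∈-filter⁻; ∈-allFin; ∈-lookup)
open import Data.List.Properties using (filter-++; length-++; map-tabulate)
open import Data.List.Relation.Unary.All as All using ()
open import Data.List.Relation.Unary.AllPairs using (_∷_)
open import Data.List.Relation.Unary.Any using (index)
open import Data.List.Relation.Unary.Any.Properties using (lookup-index)
open import Data.List.Relation.Unary.Unique.Propositional using (Unique)
import Data.List.Relation.Unary.Unique.Propositional.Properties as Unique
open import Data.Nat using (zero; suc; _<_; z≤n; s≤s; s≤s⁻¹; NonZero; >-nonZero; _≤?_; _<?_)
open import Data.Nat.Properties hiding (_≟_; suc-injective; _≤?_; _<?_)
open import Data.Nat.Tactic.RingSolver using (solve-∀)
open import Algebra.Properties.CommutativeMonoid.Sum +-0-commutativeMonoid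
  using (∑-distrib-+; ∑-comm)
open import Algebra.Properties.Semiring.Sum +-*-semiring
  using (sum; sum-cong-≗; *-distribˡ-sum; *-distribʳ-sum; sum-replicate-zero)
open import Data.Product using (∃₂; _,_; proj₁; proj₂; uncurry)
open import Data.Sum.Base using (_⊎_; inj₁; inj₂; [_,_]′)
open import Data.Sum.Properties using (inj₁-injective; inj₂-injective)
import Data.Vec.Functional as Vector
open import Data.Vec.Functional.Properties using (insertAt-lookup; insertAt-punchIn)
open import Function.Base using (_∘_; id)
open import Function.Bundles using (Equivalence)
open import Function.Definitions using (Injective)
open import Relation.Binary.Construct.Closure.ReflexiveTransitive as Star using (Star; ε; _◅_)
open import Relation.Binary.Definitions using (tri<; tri≈; tri>)
open import Relation.Binary.PropositionalEquality
open import Relation.Nullary using (¬_; Dec; yes; no; does; contradiction; ¬?; _×-dec_; _→-dec_)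
open import Relation.Nullary.Decidable using (fromWitness; toWitness; ⌊_⌋; dec-true)

-- Finite sums and the power-mean inequality.

sum-mono : ∀ {n} {f g : Fin n → ℕ} → (∀ i → f i ≤ g i) → sum f ≤ sum g
sum-mono {zero}  f≤g = z≤n
sum-mono {suc n} f≤g = +-mono-≤ (f≤g zero) (sum-mono (f≤g ∘ suc))

term≤sum : ∀ {n} (f : Fin n → ℕ) i → f i ≤ sum f
term≤sum f zero    = m≤m+n _ _
term≤sum f (suc i) = ≤-trans (term≤sum (f ∘ suc) i) (m≤n+m _ (f zero))

sum-const : ∀ n c → sum {n} (λ _ → c) ≡ n * c
sum-const zero    c = refl
sum-const (suc n) c = cong (c +_) (sum-const n c)

large-term : ∀ {n} (f : Fin n → ℕ) b → n * b < sum f → ∃ λ i → b < f i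
large-term {suc n} f b lt with b <? f zero
... | yes b<f₀ = zero , b<f₀
... | no b≮f₀  =
  let i , b<fᵢ = large-term (f ∘ suc) b
        (+-cancelˡ-< b _ _ (<-≤-trans lt (+-monoˡ-≤ _ (≮⇒≥ b≮f₀))))
  in suc i , b<fᵢ

⟦_⟧ : Bool → ℕ
⟦ true  ⟧ = 1
⟦ false ⟧ = 0

⟦⟧≤1 : ∀ b → ⟦ b ⟧ ≤ 1
⟦⟧≤1 true  = ≤-refl
⟦⟧≤1 false = z≤n

T⇒⟦⟧≡1 : ∀ {b} → T b → ⟦ b ⟧ ≡ 1
T⇒⟦⟧≡1 {true} _ = refl

0<⟦⟧⇒T : ∀ b {m} → 0 < ⟦ b ⟧ * m → T b
0<⟦⟧⇒T true _ = _

⟦∧⟧ : ∀ a b → ⟦ a ∧ b ⟧ ≡ ⟦ a ⟧ * ⟦ b ⟧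
⟦∧⟧ true  b = sym (+-identityʳ ⟦ b ⟧)
⟦∧⟧ false b = refl

count : ∀ {n} → (Fin n → Bool) → ℕ
count P = sum λ i → ⟦ P i ⟧

count-≡ : ∀ {n} (a : Fin n) → count (λ i → does (i ≟ a)) ≡ 1
count-≡ {suc n} zero    = cong suc (sum-replicate-zero n)
count-≡ {suc n} (suc a) = trans (sum-cong-≗ λ i → cong ⟦_⟧ (shift i)) (count-≡ a)
  where
  shift : ∀ i → does (suc i ≟ suc a) ≡ does (i ≟ a)
  shift i with i ≟ a
  ... | yes _ = refl
  ... | no  _ = refl

count⇒∃ : ∀ {n} (P : Fin n → Bool) → 0 < count P → ∃ λ i → T (P i)
count⇒∃ {n} P 0<P =
  let i , 0<Pᵢ = large-term (λ i → ⟦ P i ⟧) 0 (subst (_< count P) (sym (*-zeroʳ n)) 0<P)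
  in i , 0<⟦⟧⇒T (P i) (subst (0 <_) (sym (*-identityʳ _)) 0<Pᵢ)

sum-*-sum : ∀ {m n} (f : Fin m → ℕ) (g : Fin n → ℕ) →
            sum f * sum g ≡ sum λ i → sum λ j → f i * g j
sum-*-sum f g = trans (*-distribʳ-sum (sum g) f) (sum-cong-≗ λ i → *-distribˡ-sum (f i) g)

sum₂-+ : ∀ {m n} (f g : Fin m → Fin n → ℕ) →
         (sum λ i → sum λ j → f i j + g i j) ≡ (sum λ i → sum (f i)) + (sum λ i → sum (g i))
sum₂-+ f g = trans (sum-cong-≗ λ i → ∑-distrib-+ (f i) (g i)) (∑-distrib-+ (sum ∘ f) (sum ∘ g))

halve-≤ : ∀ {a b} → a + a ≤ b + b → a ≤ b
halve-≤ {a} {b} a+a≤b+b with a ≤? b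
... | yes a≤b = a≤b
... | no  a≰b = contradiction a+a≤b+b (<⇒≱ (+-mono-< (≰⇒> a≰b) (≰⇒> a≰b)))

-- For `a ≤ b` write `b = a + d` and `b ^ k = a ^ k + e`; the right side then exceeds the left by
-- exactly `d * e`.
rearrangement : ∀ k a b → a * b ^ k + b * a ^ k ≤ a * a ^ k + b * b ^ k
rearrangement k a b =
  [ ordered
  , (λ b≤a → subst₂ _≤_ (+-comm (b * a ^ k) _) (+-comm (b * b ^ k) _) (ordered b≤a))
  ]′ (≤-total a b)
  where
  expand : ∀ a d p e → a * (p + e) + (a + d) * p + d * e ≡ a * p + (a + d) * (p + e)
  expand = solve-∀

  ordered : ∀ {a b} → a ≤ b → a * b ^ k + b * a ^ k ≤ a * a ^ k + b * b ^ k
  ordered {a} {b} a≤b with m≤n⇒∃[o]m+o≡n a≤b | m≤n⇒∃[o]m+o≡n (^-monoˡ-≤ k a≤b)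
  ... | d , refl | e , eq rewrite sym eq =
    m+n≤o⇒m≤o _ (≤-reflexive (expand a d (a ^ k) e))

rotate : ∀ a b c → a * (b * c) ≡ b * (a * c)
rotate = solve-∀

module _ {n : ℕ} (w y : Fin n → ℕ) where

  private
    moment : ℕ → ℕ
    moment k = sum λ i → w i * y i ^ k

  -- Summing the rearrangement inequality over all pairs of indices.
  chebyshev : ∀ k → moment 1 * moment k ≤ moment 0 * moment (suc k)
  chebyshev k = halve-≤ (begin
    moment 1 * moment k + moment 1 * moment k
      ≡⟨ cong (moment 1 * moment k +_) (*-comm (moment 1) (moment k)) ⟩
    moment 1 * moment k + moment k * moment 1
      ≡⟨ as-double-sum 1 k k 1 ⟩
    (sum λ i → sum λ j → (w i * y i ^ 1) * (w j * y j ^ k) + (w i * y i ^ k) * (w j * y j ^ 1))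
      ≤⟨ sum-mono (λ i → sum-mono λ j → pairwise i j) ⟩
    (sum λ i → sum λ j → (w i * y i ^ 0) * (w j * y j ^ suc k) + (w i * y i ^ suc k) * (w j * y j ^ 0))
      ≡⟨ as-double-sum 0 (suc k) (suc k) 0 ⟨
    moment 0 * moment (suc k) + moment (suc k) * moment 0
      ≡⟨ cong (moment 0 * moment (suc k) +_) (*-comm (moment (suc k)) (moment 0)) ⟩
    moment 0 * moment (suc k) + moment 0 * moment (suc k) ∎)
    where
    open ≤-Reasoning

    as-double-sum : ∀ a b c d → moment a * moment b + moment c * moment d ≡
      (sum λ i → sum λ j → (w i * y i ^ a) * (w j * y j ^ b) + (w i * y i ^ c) * (w j * y j ^ d))
    as-double-sum a b c d =
      trans (cong₂ _+_ (sum-*-sum {n} {n} _ _) (sum-*-sum {n} {n} _ _)) (sym (sum₂-+ {n} {n} _ _))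

    factorˡ : ∀ u v a b p q → (u * (a * 1)) * (v * q) + (u * p) * (v * (b * 1)) ≡ u * v * (a * q + b * p)
    factorˡ = solve-∀

    factorʳ : ∀ u v a b p q → u * v * (a * p + b * q) ≡ (u * 1) * (v * (b * q)) + (u * (a * p)) * (v * 1)
    factorʳ = solve-∀

    pairwise : ∀ i j →
      (w i * y i ^ 1) * (w j * y j ^ k) + (w i * y i ^ k) * (w j * y j ^ 1) ≤
      (w i * y i ^ 0) * (w j * y j ^ suc k) + (w i * y i ^ suc k) * (w j * y j ^ 0)
    pairwise i j = begin
      (w i * y i ^ 1) * (w j * y j ^ k) + (w i * y i ^ k) * (w j * y j ^ 1)
        ≡⟨ factorˡ (w i) (w j) (y i) (y j) (y i ^ k) (y j ^ k) ⟩
      w i * w j * (y i * y j ^ k + y j * y i ^ k)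
        ≤⟨ *-monoʳ-≤ (w i * w j) (rearrangement k (y i) (y j)) ⟩
      w i * w j * (y i * y i ^ k + y j * y j ^ k)
        ≡⟨ factorʳ (w i) (w j) (y i) (y j) (y i ^ k) (y j ^ k) ⟩
      (w i * y i ^ 0) * (w j * y j ^ suc k) + (w i * y i ^ suc k) * (w j * y j ^ 0) ∎

  -- The weighted power-mean inequality with denominators cleared. Each induction step trades a
  -- factor `moment 1` for `moment 0` by `chebyshev`.
  power-mean : ∀ k → moment 1 ^ k * moment 0 ≤ moment 0 ^ k * moment k
  power-mean zero    = ≤-refl
  power-mean (suc k) = begin
    moment 1 * moment 1 ^ k * moment 0         ≡⟨ *-assoc (moment 1) (moment 1 ^ k) (moment 0) ⟩
    moment 1 * (moment 1 ^ k * moment 0)       ≤⟨ *-monoʳ-≤ (moment 1) (power-mean k) ⟩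
    moment 1 * (moment 0 ^ k * moment k)       ≡⟨ rotate (moment 1) (moment 0 ^ k) (moment k) ⟩
    moment 0 ^ k * (moment 1 * moment k)       ≤⟨ *-monoʳ-≤ (moment 0 ^ k) (chebyshev k) ⟩
    moment 0 ^ k * (moment 0 * moment (suc k)) ≡⟨ rotate (moment 0 ^ k) (moment 0) (moment (suc k)) ⟩
    moment 0 * (moment 0 ^ k * moment (suc k)) ≡⟨ *-assoc (moment 0) (moment 0 ^ k) (moment (suc k)) ⟨
    moment 0 * moment 0 ^ k * moment (suc k)   ∎
    where
    open ≤-Reasoning

-- Counting transitive tuples in a tournament.

T-∧⁺ : ∀ {a b} → T a → T b → T (a ∧ b)
T-∧⁺ p q = Equivalence.from T-∧ (p , q)

T-∧⁻ : ∀ {a b} → T (a ∧ b) → T a × T b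
T-∧⁻ = Equivalence.to T-∧

^-distribʳ-* : ∀ k m n → (m * n) ^ k ≡ m ^ k * n ^ k
^-distribʳ-* zero    m n = refl
^-distribʳ-* (suc k) m n = trans (cong (m * n *_) (^-distribʳ-* k m n)) (interchange m n (m ^ k) (n ^ k))
  where
  interchange : ∀ a b c d → a * b * (c * d) ≡ a * c * (b * d)
  interchange = solve-∀

0<*⇒0<ʳ : ∀ m {n} → 0 < m * n → 0 < n
0<*⇒0<ʳ m {zero}  lt = contradiction lt (<-irrefl (sym (*-zeroʳ m)))
0<*⇒0<ʳ m {suc n} _  = s≤s z≤n

-- In a tournament on d vertices the average in-degree is (d − 1) / 2; iterating this
-- s times produces the constants in chains-lower.
loss : ℕ → ℕ
loss zero    = 0
loss (suc s) = 2 * loss s + 1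

factor : ℕ → ℕ
factor zero    = 1
factor (suc s) = 2 ^ s * factor s

module _ {n : ℕ} (_⇒_ : Fin n → Fin n → Bool) where

  below : (Fin n → Bool) → Fin n → Fin n → Bool
  below N p u = N u ∧ (u ⇒ p)

  -- The number of s-tuples in N each of whose entries beats all earlier ones.
  chains : ℕ → (Fin n → Bool) → ℕ
  chains zero    N = 1
  chains (suc s) N = sum λ p → ⟦ N p ⟧ * chains s (below N p)

  IsChain : ∀ {s} → (Fin s → Fin n) → Set
  IsChain x = ∀ i j → i Fin.< j → T (x j ⇒ x i)

  module _ (total : ∀ u v → u ≢ v → T (u ⇒ v) ⊎ T (v ⇒ u)) where

    -- An ordered pair of distinct vertices of `N` is an arc in one of its two directions, hence
    -- counted by `B p q` or `B q p`; `D` accounts for the pairs `p = q`.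
    degree-sum : ∀ N → count N * count N ≤ 2 * (sum λ p → ⟦ N p ⟧ * count (below N p)) + count N
    degree-sum N = begin
      count N * count N
        ≡⟨ sum-*-sum w w ⟩
      (sum λ p → sum λ q → w p * w q)
        ≤⟨ sum-mono (λ p → sum-mono λ q → covered p q) ⟩
      (sum λ p → sum λ q → (B p q + B q p) + D p q)
        ≡⟨ trans (sum₂-+ (λ p q → B p q + B q p) D)
             (cong (_+ (sum λ p → sum (D p))) (sum₂-+ B (λ p q → B q p))) ⟩
      ((sum λ p → sum λ q → B p q) + (sum λ p → sum λ q → B q p)) + (sum λ p → sum λ q → D p q)
        ≡⟨ cong₂ (λ a b → ((sum λ p → sum λ q → B p q) + a) + b) (∑-comm (λ p q → B q p)) diagonal ⟩
      ((sum λ p → sum λ q → B p q) + (sum λ p → sum λ q → B p q)) + count N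
        ≡⟨ cong (λ a → a + a + count N) (sum-cong-≗ λ p → sym (*-distribˡ-sum (w p) (λ q → ⟦ below N p q ⟧))) ⟩
      X + X + count N
        ≡⟨ cong (λ a → X + a + count N) (sym (+-identityʳ X)) ⟩
      2 * X + count N ∎
      where
      open ≤-Reasoning
      w : Fin n → ℕ
      w p = ⟦ N p ⟧
      B : Fin n → Fin n → ℕ
      B p q = w p * ⟦ below N p q ⟧
      D : Fin n → Fin n → ℕ
      D p q = w p * ⟦ does (q ≟ p) ⟧
      X : ℕ
      X = sum λ p → w p * count (below N p)

      diagonal : (sum λ p → sum λ q → D p q) ≡ count N
      diagonal = sum-cong-≗ λ p → trans (sym (*-distribˡ-sum (w p) (λ q → ⟦ does (q ≟ p) ⟧)))
        (trans (cong (w p *_) (count-≡ p)) (*-identityʳ (w p)))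

      covered : ∀ p q → w p * w q ≤ (B p q + B q p) + D p q
      covered p q with N p | N q
      ... | false | _     = z≤n
      ... | true  | false = z≤n
      ... | true  | true with q ≟ p
      ...   | yes _ = m≤n+m _ _
      ...   | no q≢p with q ⇒ p | p ⇒ q | total q p q≢p
      ...     | true  | _    | _      = s≤s z≤n
      ...     | false | true | _      = s≤s z≤n
      ...     | false | false | inj₁ ()
      ...     | false | false | inj₂ ()

    -- Induction on `s`, fixing the first entry `p`. The induction hypothesis bounds the tuples
    -- below `p` from below by an `s`-th power, so the power mean reduces the sum over `p` to the
    -- average in-degree, which `degree-sum` controls.
    chains-lower : ∀ s N → (count N ∸ loss s) ^ s ≤ factor s * chains s N
    chains-lower zero    N = ≤-refl
    chains-lower (suc s) N = cancel (count N) refl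
      where
      open ≤-Reasoning
      d e b Y Z : ℕ
      d = count N
      b = loss s
      e = d ∸ (2 * b + 1)
      w y : Fin n → ℕ
      w p = ⟦ N p ⟧
      y p = count (below N p) ∸ b
      Y = sum λ p → w p * y p
      Z = sum λ p → w p * y p ^ s

      excess : (sum λ p → w p * count (below N p)) ≤ b * d + Y
      excess = begin
        (sum λ p → w p * count (below N p))
          ≤⟨ sum-mono (λ p → ≤-trans (*-monoʳ-≤ (w p) (m≤n+m∸n (count (below N p)) b))
               (≤-reflexive (trans (*-distribˡ-+ (w p) b (y p)) (cong (_+ (w p * y p)) (*-comm (w p) b))))) ⟩
        (sum λ p → b * w p + w p * y p)
          ≡⟨ ∑-distrib-+ (λ p → b * w p) (λ p → w p * y p) ⟩
        (sum λ p → b * w p) + Y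
          ≡⟨ cong (_+ Y) (*-distribˡ-sum b w) ⟨
        b * d + Y ∎

      -- The bound `d * d ≤ d * (2 * b + 1) + 2 * Y` obtained here dictates the recursion of `loss`.
      de≤2Y : d * e ≤ 2 * Y
      de≤2Y = begin
        d * (d ∸ (2 * b + 1))      ≡⟨ *-distribˡ-∸ d d (2 * b + 1) ⟩
        d * d ∸ d * (2 * b + 1)    ≤⟨ m≤n+o⇒m∸n≤o (d * d) (d * (2 * b + 1)) (begin
          d * d                                              ≤⟨ degree-sum N ⟩
          2 * (sum λ p → w p * count (below N p)) + d        ≤⟨ +-monoˡ-≤ d (*-monoʳ-≤ 2 excess) ⟩
          2 * (b * d + Y) + d                                ≡⟨ regroup b d Y ⟩
          d * (2 * b + 1) + 2 * Y                            ∎) ⟩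
        2 * Y ∎
        where
        regroup : ∀ b d Y → 2 * (b * d + Y) + d ≡ d * (2 * b + 1) + 2 * Y
        regroup = solve-∀

      Z≤ : Z ≤ factor s * chains (suc s) N
      Z≤ = begin
        Z ≤⟨ sum-mono (λ p → *-monoʳ-≤ (w p) (chains-lower s (below N p))) ⟩
        (sum λ p → w p * (factor s * chains s (below N p)))
          ≡⟨ sum-cong-≗ (λ p → rotate (w p) (factor s) (chains s (below N p))) ⟩
        (sum λ p → factor s * (w p * chains s (below N p)))
          ≡⟨ *-distribˡ-sum (factor s) (λ p → w p * chains s (below N p)) ⟨
        factor s * chains (suc s) N ∎

      mean : Y ^ s * d ≤ d ^ s * Z
      mean = subst₂ (λ Y d → Y ^ s * d ≤ d ^ s * Z)
        (sum-cong-≗ λ p → cong (w p *_) (*-identityʳ (y p))) (sum-cong-≗ λ p → *-identityʳ (w p))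
        (power-mean w y s)

      scaled : d ^ s * (e ^ s * d) ≤ d ^ s * (2 ^ s * Z)
      scaled = begin
        d ^ s * (e ^ s * d)  ≡⟨ *-assoc (d ^ s) (e ^ s) d ⟨
        d ^ s * e ^ s * d    ≡⟨ cong (_* d) (^-distribʳ-* s d e) ⟨
        (d * e) ^ s * d      ≤⟨ *-monoˡ-≤ d (^-monoˡ-≤ s de≤2Y) ⟩
        (2 * Y) ^ s * d      ≡⟨ cong (_* d) (^-distribʳ-* s 2 Y) ⟩
        2 ^ s * Y ^ s * d    ≡⟨ *-assoc (2 ^ s) (Y ^ s) d ⟩
        2 ^ s * (Y ^ s * d)  ≤⟨ *-monoʳ-≤ (2 ^ s) mean ⟩
        2 ^ s * (d ^ s * Z)  ≡⟨ rotate (2 ^ s) (d ^ s) Z ⟩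
        d ^ s * (2 ^ s * Z)  ∎

      cancel : ∀ m → d ≡ m → e ^ suc s ≤ factor (suc s) * chains (suc s) N
      -- The factor `d ^ s` can be cancelled only for positive `d`; for `d = 0` the truncated `e` is
      -- 0 and the left side vanishes.
      cancel zero    d≡0 = subst (λ d → (d ∸ (2 * b + 1)) ^ suc s ≤ factor (suc s) * chains (suc s) N) (sym d≡0)
        (subst (λ z → z ^ suc s ≤ factor (suc s) * chains (suc s) N) (sym (0∸n≡0 (2 * b + 1))) z≤n)
      cancel (suc m) d≡ = begin
        e * e ^ s    ≤⟨ *-monoˡ-≤ (e ^ s) (m∸n≤m d (2 * b + 1)) ⟩
        d * e ^ s    ≡⟨ *-comm d (e ^ s) ⟩
        e ^ s * d    ≤⟨ *-cancelˡ-≤ (d ^ s) {{d^s≢0}} scaled ⟩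
        2 ^ s * Z    ≤⟨ *-monoʳ-≤ (2 ^ s) Z≤ ⟩
        2 ^ s * (factor s * chains (suc s) N) ≡⟨ *-assoc (2 ^ s) (factor s) _ ⟨
        factor (suc s) * chains (suc s) N ∎
        where
        d^s≢0 : NonZero (d ^ s)
        d^s≢0 = m^n≢0 d s {{subst NonZero (sym d≡) _}}

  -- The Kővári-Sós-Turán pigeonhole, one entry at a time: interchanging the sums over `v` and `p`
  -- yields a `p` whose share exceeds the average. `W` then shrinks to the `v` with `p` in `N v`,
  -- and each `N v` to `below (N v) p`.
  popular-chain : ∀ {k} s M (N : Fin k → Fin n → Bool) (W : Fin k → Bool) →
    M * n ^ s < (sum λ v → ⟦ W v ⟧ * chains s (N v)) →
    ∃ λ (x : Fin s → Fin n) → IsChain x ×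
      ∃ λ W′ → M < count W′ × (∀ v → T (W′ v) → T (W v) × (∀ i → T (N v (x i))))
  popular-chain zero M N W lt =
    (λ ()) , (λ ()) , W ,
    subst₂ _<_ (*-identityʳ M) (sum-cong-≗ λ v → *-identityʳ ⟦ W v ⟧) lt , λ v Wv → Wv , λ ()
  popular-chain {k} (suc s) M N W lt with large-term
    (λ p → sum λ v → ⟦ W v ∧ N v p ⟧ * chains s (below (N v) p)) (M * n ^ s) (begin-strict
      n * (M * n ^ s)   ≡⟨ rotate n M (n ^ s) ⟩
      M * (n * n ^ s)   <⟨ lt ⟩
      (sum λ v → ⟦ W v ⟧ * (sum λ p → ⟦ N v p ⟧ * chains s (below (N v) p)))
        ≡⟨ (sum-cong-≗ λ v → trans (*-distribˡ-sum ⟦ W v ⟧ (λ p → ⟦ N v p ⟧ * chains s (below (N v) p)))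
             (sum-cong-≗ λ p → trans (sym (*-assoc ⟦ W v ⟧ ⟦ N v p ⟧ _))
                                     (cong (_* _) (sym (⟦∧⟧ (W v) (N v p)))))) ⟩
      (sum λ v → sum λ p → ⟦ W v ∧ N v p ⟧ * chains s (below (N v) p))
        ≡⟨ ∑-comm (λ v p → ⟦ W v ∧ N v p ⟧ * chains s (below (N v) p)) ⟩
      (sum λ p → sum λ v → ⟦ W v ∧ N v p ⟧ * chains s (below (N v) p)) ∎)
    where
    open ≤-Reasoning
  ... | p , lt′ with popular-chain s M (λ v → below (N v) p) (λ v → W v ∧ N v p) lt′
  ...   | x , chain , W′ , M<W′ , W′⇒ = p Vector.∷ x , chain′ , W′ , M<W′ , λ v W′v →
    proj₁ (T-∧⁻ (proj₁ (W′⇒ v W′v))) ,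
    λ { zero → proj₂ (T-∧⁻ (proj₁ (W′⇒ v W′v))) ; (suc i) → proj₁ (T-∧⁻ (proj₂ (W′⇒ v W′v) i)) }
    where
    -- That the later entries beat the new head is recorded only in the sets `below (N v) p`, so
    -- some `v` in the nonempty `W′` has to be inspected.
    chain′ : IsChain (p Vector.∷ x)
    chain′ zero (suc j) _ =
      let v , W′v = count⇒∃ W′ (≤-<-trans z≤n M<W′)
      in proj₂ (T-∧⁻ (proj₂ (W′⇒ v W′v) j))
    chain′ (suc i) (suc j) (s≤s i<j) = chain i j i<j

  module _ (total : ∀ u v → u ≢ v → T (u ⇒ v) ⊎ T (v ⇒ u)) where

    -- `chains-lower` makes the number of chains positive; `popular-chain` with a single index and
    -- `M = 0` extracts one of them.
    chain-within : ∀ t W → loss t < count W →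
      ∃ λ (x : Fin t → Fin n) → IsChain x × (∀ i → T (W (x i)))
    chain-within t W large =
      let x , chain , W′ , 0<W′ , W′⇒ = popular-chain {1} t 0 (λ _ → W) (λ _ → true)
            (subst (0 <_) (sym (trans (+-identityʳ _) (+-identityʳ (chains t W)))) (0<chains t large))
          v , W′v = count⇒∃ W′ 0<W′
      in x , chain , proj₂ (W′⇒ v W′v)
      where
      0<chains : ∀ t → loss t < count W → 0 < chains t W
      0<chains t large = 0<*⇒0<ʳ (factor t) (<-≤-trans
        (m^n>0 (count W ∸ loss t) {{>-nonZero (m<n⇒0<n∸m large)}} t) (chains-lower total t W))

-- Leaves and vertex orderings of forests.

Adj⇒≢ : ∀ {n} (G : Graph n) {u v} → Adj G u v → u ≢ v
Adj⇒≢ G {u} uv refl = subst T (adj-irrefl G u) uv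

Adj-sym : ∀ {n} (G : Graph n) {u v} → Adj G u v → Adj G v u
Adj-sym G {u} {v} = subst T (adj-sym G u v)

-- Two vertices are built in: the second is the neighbour that `prolong` must avoid when it leaves
-- the first.
record Path {n} (G : Graph n) (l : ℕ) : Set where
  field
    vertexAt : Fin (2 + l) → Fin n
    distinct : Injective _≡_ _≡_ vertexAt
    edgeAt   : ∀ (i : Fin (1 + l)) → Adj G (vertexAt (inject₁ i)) (vertexAt (suc i))

-- A path can be prolonged at its start until the new neighbour already lies on it.
module _ {n : ℕ} (G : Graph n) (next : ∀ v u → ∃ λ w → Adj G v w × w ≢ u) where

  open Path

  closeUp : ∀ {l} (p : Path G l) (j : Fin l) → Adj G (vertexAt p zero) (vertexAt p (suc (suc j))) → Cycle G
  closeUp {l} p j chord = record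
    { k         = toℕ j
    ; vertex    = λ i → vertexAt p (inject≤ i bound)
    ; injective = λ eq → inject≤-injective bound bound _ _ (distinct p eq)
    ; step      = λ i → subst (λ x → Adj G (vertexAt p x) (vertexAt p (inject≤ (suc i) bound))) (shift i)
                          (edgeAt p (inject≤ i (s≤s⁻¹ bound)))
    ; closing   = Adj-sym G (subst (Adj G (vertexAt p zero) ∘ vertexAt p) (sym top) chord)
    }
    where
    bound : 3 + toℕ j ≤ 2 + l
    bound = s≤s (s≤s (toℕ<n j))

    shift : ∀ i → inject₁ (inject≤ i (s≤s⁻¹ bound)) ≡ inject≤ (inject₁ i) bound
    shift i = toℕ-injective (trans (toℕ-inject₁ _) (trans (toℕ-inject≤ i (s≤s⁻¹ bound))
                (trans (sym (toℕ-inject₁ i)) (sym (toℕ-inject≤ (inject₁ i) bound)))))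

    top : inject≤ (fromℕ (2 + toℕ j)) bound ≡ suc (suc j)
    top = toℕ-injective (trans (toℕ-inject≤ (fromℕ (2 + toℕ j)) bound) (toℕ-fromℕ (2 + toℕ j)))

  -- `fuel` plus the number of vertices on the path stays above `n`; at `fuel = 0` the path would
  -- have more than `n` distinct vertices.
  prolong : ∀ fuel {l} → Path G l → n < fuel + (2 + l) → Cycle G
  prolong zero    p n<l = contradiction (injective⇒≤ (distinct p)) (<⇒≱ n<l)
  prolong (suc f) {l} p n<l with next (vertexAt p zero) (vertexAt p (suc zero))
  ... | w , vw , w≢ with any? (λ i → vertexAt p i ≟ w)
  ...   | yes (zero , refl)        = contradiction refl (Adj⇒≢ G vw)
  ...   | yes (suc zero , refl)    = contradiction refl w≢
  ...   | yes (suc (suc j) , refl) = closeUp p j vw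
  ...   | no fresh = prolong f longer (subst (n <_) (sym (+-suc f (2 + l))) n<l)
    where
    longer : Path G (suc l)
    longer = record
      { vertexAt = w Vector.∷ vertexAt p
      ; distinct = λ
          { {zero}  {zero}  _  → refl
          ; {zero}  {suc j} eq → contradiction (j , sym eq) fresh
          ; {suc i} {zero}  eq → contradiction (i , eq) fresh
          ; {suc i} {suc j} eq → cong suc (distinct p eq)
          }
      ; edgeAt   = λ { zero → Adj-sym G vw ; (suc i) → edgeAt p i }
      }

  cycle-from : Fin n → Cycle G
  cycle-from v with next v v
  ... | w , vw , w≢v = prolong n start (m<m+n n (s≤s z≤n))
    where
    start : Path G 0
    start = record
      { vertexAt = λ { zero → v ; (suc _) → w }
      ; distinct = λ
          { {zero}     {zero}     _  → refl
          ; {zero}     {suc zero} eq → contradiction (sym eq) w≢v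
          ; {suc zero} {zero}     eq → contradiction eq w≢v
          ; {suc zero} {suc zero} _  → refl
          }
      ; edgeAt   = λ { zero → vw }
      }

-- If there is no such vertex, every vertex has a neighbour other than any prescribed one, and
-- `cycle-from` applies. An isolated vertex also counts as a leaf, with arbitrary `u`.
leaf : ∀ {n} (G : Graph (suc n)) → ¬ Cycle G → ∃₂ λ v u → ∀ w → Adj G v w → w ≡ u
leaf G acyclic with any? (λ v → any? λ u → all? λ w → T? (adj G v w) →-dec (w ≟ u))
... | yes found = found
... | no  none  = contradiction (cycle-from G next zero) acyclic
  where
  next : ∀ v u → ∃ λ w → Adj G v w × w ≢ u
  next v u with any? (λ w → T? (adj G v w) ×-dec ¬? (w ≟ u))
  ... | yes found = found
  ... | no  stuck = contradiction (v , u , only) none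
    where
    only : ∀ w → Adj G v w → w ≡ u
    only w vw with w ≟ u
    ... | yes w≡u = w≡u
    ... | no  w≢u = contradiction (w , vw , w≢u) stuck

-- For a tree, these are the orderings in which every vertex comes after its parent.
ForestOrder : ∀ {n} → Graph n → (Fin n → Fin n) → Set
ForestOrder G pos = Injective _≡_ _≡_ pos ×
  (∀ u v w → Adj G u v → Adj G u w → pos v Fin.< pos u → pos w Fin.< pos u → v ≡ w)

-- Order the graph without a leaf and put the leaf last. It has at most one neighbour, and being
-- last it precedes no other vertex.
forest-order : ∀ {n} (G : Graph n) → ¬ Cycle G → ∃ (ForestOrder G)
forest-order {zero}  G acyclic = id , id , λ ()
forest-order {suc n} G acyclic = pos′ , pos′-injective , pos′-unique
  where
  ℓ parent : Fin (suc n)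
  ℓ      = proj₁ (leaf G acyclic)
  parent = proj₁ (proj₂ (leaf G acyclic))

  only : ∀ w → Adj G ℓ w → w ≡ parent
  only = proj₂ (proj₂ (leaf G acyclic))

  G−ℓ : Graph n
  G−ℓ = mkGraph (λ i j → adj G (punchIn ℓ i) (punchIn ℓ j)) (λ i j → adj-sym G _ _) (λ i → adj-irrefl G _)

  restore : Cycle G−ℓ → Cycle G
  restore C = record
    { k = k ; vertex = punchIn ℓ ∘ vertex ; injective = injective ∘ punchIn-injective ℓ _ _
    ; step = step ; closing = closing }
    where open Cycle C

  order : ∃ (ForestOrder G−ℓ)
  order = forest-order G−ℓ (acyclic ∘ restore)

  pos : Fin n → Fin n
  pos = proj₁ order

  pos′ : Fin (suc n) → Fin (suc n)
  pos′ = Vector.insertAt (inject₁ ∘ pos) ℓ (fromℕ n)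

  data View : Fin (suc n) → Fin (suc n) → Set where
    isLeaf : View ℓ (fromℕ n)
    other  : ∀ i → View (punchIn ℓ i) (inject₁ (pos i))

  view : ∀ x → View x (pos′ x)
  view x with ℓ ≟ x
  ... | yes refl = subst (View ℓ) (sym (insertAt-lookup (inject₁ ∘ pos) ℓ (fromℕ n))) isLeaf
  ... | no  ℓ≢x  = subst (λ x → View x (pos′ x)) (punchIn-punchOut ℓ≢x)
    (subst (View _) (sym (insertAt-punchIn (inject₁ ∘ pos) ℓ (fromℕ n) (punchOut ℓ≢x))) (other (punchOut ℓ≢x)))

  view-injective : ∀ {x y a b} → View x a → View y b → a ≡ b → x ≡ y
  view-injective isLeaf    isLeaf    _  = refl
  view-injective isLeaf    (other j) eq = contradiction eq fromℕ≢inject₁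
  view-injective (other i) isLeaf    eq = contradiction (sym eq) fromℕ≢inject₁
  view-injective (other i) (other j) eq = cong (punchIn ℓ) (proj₁ (proj₂ order) (inject₁-injective eq))

  pos′-injective : Injective _≡_ _≡_ pos′
  pos′-injective = view-injective (view _) (view _)

  top≮ : ∀ i → ¬ (fromℕ n Fin.< inject₁ i)
  top≮ i lt = <-asym (subst₂ _<_ (toℕ-fromℕ n) (toℕ-inject₁ i) lt) (toℕ<n i)

  lower : ∀ {i j : Fin n} → inject₁ i Fin.< inject₁ j → i Fin.< j
  lower {i} {j} = subst₂ _<_ (toℕ-inject₁ i) (toℕ-inject₁ j)

  view-unique : ∀ {u v w a b c} → View u a → View v b → View w c →
    Adj G u v → Adj G u w → b Fin.< a → c Fin.< a → v ≡ w
  view-unique isLeaf    _         _         uv uw _   _   = trans (only _ uv) (sym (only _ uw))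
  view-unique (other i) isLeaf    _         uv uw b<a _   = contradiction b<a (top≮ (pos i))
  view-unique (other i) (other j) isLeaf    uv uw _   c<a = contradiction c<a (top≮ (pos i))
  view-unique (other i) (other j) (other k) uv uw b<a c<a =
    cong (punchIn ℓ) (proj₂ (proj₂ order) i j k uv uw (lower b<a) (lower c<a))

  pos′-unique : ∀ u v w → Adj G u v → Adj G u w → pos′ v Fin.< pos′ u → pos′ w Fin.< pos′ u → v ≡ w
  pos′-unique u v w = view-unique (view u) (view v) (view w)

-- Upper bound: arcs of a star-colouring and rainbow joins.

splitAt-injective : ∀ s {t} → Injective _≡_ _≡_ (splitAt s {t})
splitAt-injective s {t} {u} {v} eq =
  trans (sym (join-splitAt s t u)) (trans (cong (Fin.join s t) eq) (join-splitAt s t v))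

module Arcs {n k : ℕ} (χ : StarColouring n k) where

  col : Fin n → Fin n → Fin k
  col = colour χ

  centre : Fin k → Fin n
  centre c = proj₁ (star χ c)

  centre-on : ∀ {u v} → u ≢ v → u ≡ centre (col u v) ⊎ v ≡ centre (col u v)
  centre-on u≢v = proj₂ (star χ _) _ _ u≢v refl

  spoke : ∀ c → ∃ λ v → centre c ≢ v × col (centre c) v ≡ c
  spoke c with used χ c
  ... | i , j , i≢j , ij≡c with proj₂ (star χ c) i j i≢j ij≡c
  ...   | inj₁ refl = j , i≢j , ij≡c
  ...   | inj₂ refl = i , i≢j ∘ sym , trans (colour-sym χ j i (i≢j ∘ sym)) ij≡c

  tip : Fin k → Fin n
  tip c = proj₁ (spoke c)

  centre≢tip : ∀ c → centre c ≢ tip c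
  centre≢tip c = proj₁ (proj₂ (spoke c))

  col-spoke : ∀ c → col (centre c) (tip c) ≡ c
  col-spoke c = proj₂ (proj₂ (spoke c))

  _⇒_ : Fin n → Fin n → Bool
  u ⇒ v = ⌊ ¬? (u ≟ v) ×-dec (centre (col u v) ≟ u) ⌋

  ⇒-≢ : ∀ {u v} → T (u ⇒ v) → u ≢ v
  ⇒-≢ = proj₁ ∘ toWitness

  ⇒-centre : ∀ {u v} → T (u ⇒ v) → centre (col u v) ≡ u
  ⇒-centre = proj₂ ∘ toWitness

  ⇒-total : ∀ u v → u ≢ v → T (u ⇒ v) ⊎ T (v ⇒ u)
  ⇒-total u v u≢v with centre-on u≢v
  ... | inj₁ u≡c = inj₁ (fromWitness (u≢v , sym u≡c))
  ... | inj₂ v≡c = inj₂ (fromWitness (u≢v ∘ sym ,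
    trans (cong centre (colour-sym χ v u (u≢v ∘ sym))) (sym v≡c)))

  -- Each colour c contributes exactly one arc, namely centre c → tip c.
  Arc : Fin n → Fin n → Set
  Arc u v = centre (col u v) ≡ u × tip (col u v) ≡ v

  arc? : ∀ u v → Dec (Arc u v)
  arc? u v = (centre (col u v) ≟ u) ×-dec (tip (col u v) ≟ v)

  arc-≢ : ∀ {u v} → Arc u v → u ≢ v
  arc-≢ (c≡u , t≡v) u≡v = centre≢tip _ (trans c≡u (trans u≡v (sym t≡v)))

  -- The arguments are flipped so that `inArc v`, the tails of the chosen arcs into `v`, can serve
  -- as the set `N v` of `popular-chain`.
  inArc : Fin n → Fin n → Bool
  inArc v u = ⌊ arc? u v ⌋

  inArc-spoke : ∀ c → T (inArc (tip c) (centre c))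
  inArc-spoke c = fromWitness (cong centre (col-spoke c) , cong tip (col-spoke c))

  -- Double counting of colours against arcs: each `c` is the colour of the arc from `centre c` to
  -- `tip c`, and an arc has only one colour.
  colours≤arcs : k ≤ sum λ v → count (inArc v)
  colours≤arcs = begin
    k                                                    ≡⟨ trans (sum-const k 1) (*-identityʳ k) ⟨
    (sum λ (c : Fin k) → 1)                              ≤⟨ sum-mono single ⟩
    (sum λ c → sum λ v → sum λ u → F c v u)              ≡⟨ ∑-comm (λ c v → sum λ u → F c v u) ⟩
    (sum λ v → sum λ c → sum λ u → F c v u)              ≡⟨ (sum-cong-≗ λ v → trans (∑-comm (λ c u → F c v u))
                                                                    (sum-cong-≗ λ u → collapse v u)) ⟩
    (sum λ v → count (inArc v))                          ∎
    where
    open ≤-Reasoning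

    F : Fin k → Fin n → Fin n → ℕ
    F c v u = ⟦ inArc v u ⟧ * ⟦ does (c ≟ col u v) ⟧

    collapse : ∀ v u → (sum λ c → F c v u) ≡ ⟦ inArc v u ⟧
    collapse v u = trans (sym (*-distribˡ-sum ⟦ inArc v u ⟧ (λ c → ⟦ does (c ≟ col u v) ⟧)))
      (trans (cong (⟦ inArc v u ⟧ *_) (count-≡ (col u v))) (*-identityʳ _))

    single : ∀ c → 1 ≤ sum λ v → sum λ u → F c v u
    single c = begin
      1                                    ≡⟨ cong₂ _*_ (T⇒⟦⟧≡1 (inArc-spoke c))
                                                   (cong ⟦_⟧ (dec-true (c ≟ _) (sym (col-spoke c)))) ⟨
      F c (tip c) (centre c)               ≤⟨ term≤sum (F c (tip c)) (centre c) ⟩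
      (sum λ u → F c (tip c) u)            ≤⟨ term≤sum (λ v → sum λ u → F c v u) (tip c) ⟩
      (sum λ v → sum λ u → F c v u)        ∎

  chain-injective : ∀ {s} {x : Fin s → Fin n} → IsChain _⇒_ x → Injective _≡_ _≡_ x
  chain-injective chain {i} {j} eq with <ᶠ-cmp i j
  ... | tri< i<j _ _ = contradiction (sym eq) (⇒-≢ (chain i j i<j))
  ... | tri≈ _ i≡j _ = i≡j
  ... | tri> _ _ j<i = contradiction eq (⇒-≢ (chain j i j<i))

  module _ {s t : ℕ} {T₁ : Graph s} {T₂ : Graph t}
           {pos₁ : Fin s → Fin s} (order₁ : ForestOrder T₁ pos₁)
           {pos₂ : Fin t → Fin t} (order₂ : ForestOrder T₂ pos₂)
           {x : Fin s → Fin n} (x-chain : IsChain _⇒_ x)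
           {y : Fin t → Fin n} (y-chain : IsChain _⇒_ y)
           (arcs : ∀ i j → Arc (x i) (y j))
           (avoids : ∀ i l j → y j ≢ tip (col (x i) (x l))) where

    place : Fin s ⊎ Fin t → Fin n
    place (inj₁ i) = x (pos₁ i)
    place (inj₂ j) = y (pos₂ j)

    place-injective : Injective _≡_ _≡_ place
    place-injective {inj₁ i} {inj₁ l} eq = cong inj₁ (proj₁ order₁ (chain-injective x-chain eq))
    place-injective {inj₁ i} {inj₂ j} eq = contradiction eq (arc-≢ (arcs _ _))
    place-injective {inj₂ j} {inj₁ i} eq = contradiction (sym eq) (arc-≢ (arcs _ _))
    place-injective {inj₂ j} {inj₂ l} eq = cong inj₂ (proj₁ order₂ (chain-injective y-chain eq))

    -- The edges of the join directed away from the centres of their colours: tree edges run to the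
    -- earlier endpoint, cross edges from the first tuple to the second.
    data Outgoing : Fin s ⊎ Fin t → Fin s ⊎ Fin t → Set where
      inner₁ : ∀ {i l} → Adj T₁ i l → pos₁ l Fin.< pos₁ i → Outgoing (inj₁ i) (inj₁ l)
      inner₂ : ∀ {j l} → Adj T₂ j l → pos₂ l Fin.< pos₂ j → Outgoing (inj₂ j) (inj₂ l)
      cross  : ∀ {i j} → Outgoing (inj₁ i) (inj₂ j)

    outgoing-centre : ∀ {p q} → Outgoing p q → centre (col (place p) (place q)) ≡ place p
    outgoing-centre (inner₁ _ lt) = ⇒-centre (x-chain _ _ lt)
    outgoing-centre (inner₂ _ lt) = ⇒-centre (y-chain _ _ lt)
    outgoing-centre cross         = proj₁ (arcs _ _)

    orient : ∀ p q → T (joinAdj T₁ T₂ p q) → Outgoing p q ⊎ Outgoing q p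
    orient (inj₁ i) (inj₁ l) il with <ᶠ-cmp (pos₁ i) (pos₁ l)
    ... | tri< i<l _ _ = inj₂ (inner₁ (Adj-sym T₁ il) i<l)
    ... | tri≈ _ i≡l _ = contradiction (proj₁ order₁ i≡l) (Adj⇒≢ T₁ il)
    ... | tri> _ _ l<i = inj₁ (inner₁ il l<i)
    orient (inj₂ j) (inj₂ l) jl with <ᶠ-cmp (pos₂ j) (pos₂ l)
    ... | tri< j<l _ _ = inj₂ (inner₂ (Adj-sym T₂ jl) j<l)
    ... | tri≈ _ j≡l _ = contradiction (proj₁ order₂ j≡l) (Adj⇒≢ T₂ jl)
    ... | tri> _ _ l<j = inj₁ (inner₂ jl l<j)
    orient (inj₁ i) (inj₂ j) _ = inj₁ cross
    orient (inj₂ j) (inj₁ i) _ = inj₂ cross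

    -- Within a tree, a vertex has only one edge to an earlier vertex. Two cross edges of one colour
    -- end at the tip of that colour, and `avoids` separates a cross edge from a tree edge.
    outgoing-target : ∀ {p q q′} → Outgoing p q → Outgoing p q′ →
      col (place p) (place q) ≡ col (place p) (place q′) → q ≡ q′
    outgoing-target (inner₁ il l<i) (inner₁ im m<i) _ = cong inj₁ (proj₂ order₁ _ _ _ il im l<i m<i)
    outgoing-target (inner₂ jl l<j) (inner₂ jm m<j) _ = cong inj₂ (proj₂ order₂ _ _ _ jl jm l<j m<j)
    outgoing-target cross cross eq =
      cong inj₂ (proj₁ order₂ (chain-injective y-chain
        (trans (sym (proj₂ (arcs _ _))) (trans (cong tip eq) (proj₂ (arcs _ _))))))
    outgoing-target (inner₁ _ _) cross eq =
      contradiction (trans (sym (proj₂ (arcs _ _))) (cong tip (sym eq))) (avoids _ _ _)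
    outgoing-target cross (inner₁ _ _) eq =
      contradiction (trans (sym (proj₂ (arcs _ _))) (cong tip eq)) (avoids _ _ _)

    outgoing-unique : ∀ {p q p′ q′} → Outgoing p q → Outgoing p′ q′ →
      col (place p) (place q) ≡ col (place p′) (place q′) → p ≡ p′ × q ≡ q′
    outgoing-unique {p} {_} {p′} o o′ eq with place-injective {p} {p′}
      (trans (sym (outgoing-centre o)) (trans (cong centre eq) (outgoing-centre o′)))
    ... | refl = refl , outgoing-target o o′ eq

    embedded : RainbowCopy χ (join T₁ T₂)
    embedded = place ∘ splitAt s , splitAt-injective s ∘ place-injective , rainbow
      where
      flip-col : ∀ p q → T (joinAdj T₁ T₂ p q) → col (place q) (place p) ≡ col (place p) (place q)
      flip-col p q pq = colour-sym χ _ _ λ eq →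
        subst T (trans (cong (λ r → joinAdj T₁ T₂ r q) (sym (place-injective {q} {p} eq)))
                       (joinAdj-irrefl T₁ T₂ q)) pq

      back : ∀ {u v : Fin (s + t)} → splitAt s u ≡ splitAt s v → u ≡ v
      back = splitAt-injective s

      rainbow : ∀ u v u′ v′ → Adj (join T₁ T₂) u v → Adj (join T₁ T₂) u′ v′ →
        col (place (splitAt s u)) (place (splitAt s v)) ≡ col (place (splitAt s u′)) (place (splitAt s v′)) →
        SameEdge u v u′ v′
      rainbow u v u′ v′ uv uv′ eq
        with orient (splitAt s u) (splitAt s v) uv | orient (splitAt s u′) (splitAt s v′) uv′
      ... | inj₁ o | inj₁ o′ =
        let p , q = outgoing-unique o o′ eq
        in inj₁ (back p , back q)
      ... | inj₁ o | inj₂ o′ =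
        let p , q = outgoing-unique o o′ (trans eq (sym (flip-col (splitAt s u′) (splitAt s v′) uv′)))
        in inj₂ (back p , back q)
      ... | inj₂ o | inj₁ o′ =
        let p , q = outgoing-unique o o′ (trans (flip-col (splitAt s u) (splitAt s v) uv) eq)
        in inj₂ (back q , back p)
      ... | inj₂ o | inj₂ o′ =
        let p , q = outgoing-unique o o′
              (trans (flip-col (splitAt s u) (splitAt s v) uv)
                (trans eq (sym (flip-col (splitAt s u′) (splitAt s v′) uv′))))
        in inj₁ (back q , back p)

  -- `popular-chain` gives `x` with more than `loss t + s * s` common out-neighbours along arcs. At
  -- most `s * s` of them are forbidden tips `endpoint i l`; among the others `chain-within` finds
  -- `y`.
  rainbow-join : ∀ {s t} (T₁ : Graph s) (T₂ : Graph t) → ¬ Cycle T₁ → ¬ Cycle T₂ →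
    (loss t + s * s) * n ^ s < (sum λ v → chains _⇒_ s (inArc v)) → RainbowCopy χ (join T₁ T₂)
  rainbow-join {s} {t} T₁ T₂ acyclic₁ acyclic₂ many
    with popular-chain _⇒_ s (loss t + s * s) inArc (λ _ → true)
           (subst (_ <_) (sum-cong-≗ λ v → sym (+-identityʳ (chains _⇒_ s (inArc v)))) many)
  ... | x , x-chain , W , large , W⇒arcs =
    embedded (proj₂ (forest-order T₁ acyclic₁)) (proj₂ (forest-order T₂ acyclic₂))
      x-chain (proj₁ (proj₂ chain-W′))
      (λ i j → toWitness (proj₂ (W⇒arcs _ (proj₁ (T-∧⁻ {W _} (in-W′ j)))) i))
      (λ i l j → toWitness {a? = fresh? _} (proj₂ (T-∧⁻ {W _} (in-W′ j))) i l)
    where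
    open ≤-Reasoning

    endpoint : Fin s → Fin s → Fin n
    endpoint i l = tip (col (x i) (x l))

    fresh? : ∀ v → Dec (∀ i l → v ≢ endpoint i l)
    fresh? v = all? λ i → all? λ l → ¬? (v ≟ endpoint i l)

    W′ : Fin n → Bool
    W′ v = W v ∧ ⌊ fresh? v ⌋

    -- Counted with multiplicity: each of the `s * s` pairs hits exactly one vertex, so the total is
    -- exact whatever coincidences occur.
    hits : Fin n → ℕ
    hits v = sum λ i → sum λ l → ⟦ does (v ≟ endpoint i l) ⟧

    kept-or-hit : ∀ v → ⟦ W v ⟧ ≤ ⟦ W′ v ⟧ + hits v
    kept-or-hit v with fresh? v
    ... | yes _ = ≤-trans (≤-reflexive (cong ⟦_⟧ (sym (∧-identityʳ (W v))))) (m≤m+n _ _)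
    ... | no stale with any? (λ i → any? λ l → v ≟ endpoint i l)
    ...   | no unhit = contradiction (λ i l v≡ → unhit (i , l , v≡)) stale
    ...   | yes (i , l , v≡) = begin
      ⟦ W v ⟧                                        ≤⟨ ⟦⟧≤1 (W v) ⟩
      1                                              ≡⟨ cong ⟦_⟧ (dec-true (v ≟ endpoint i l) v≡) ⟨
      ⟦ does (v ≟ endpoint i l) ⟧                    ≤⟨ term≤sum (λ l → ⟦ does (v ≟ endpoint i l) ⟧) l ⟩
      (sum λ l → ⟦ does (v ≟ endpoint i l) ⟧)        ≤⟨ term≤sum (λ i → sum λ l → ⟦ does (v ≟ endpoint i l) ⟧) i ⟩
      hits v                                         ≤⟨ m≤n+m (hits v) _ ⟩
      ⟦ W v ∧ false ⟧ + hits v                       ∎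

    total-hits : sum hits ≡ s * s
    total-hits =
      trans (∑-comm (λ v i → sum λ l → ⟦ does (v ≟ endpoint i l) ⟧))
        (trans (sum-cong-≗ λ i → trans (∑-comm (λ v l → ⟦ does (v ≟ endpoint i l) ⟧))
                 (trans (sum-cong-≗ λ l → count-≡ (endpoint i l)) (trans (sum-const s 1) (*-identityʳ s))))
          (sum-const s s))

    W′-large : loss t < count W′
    W′-large = +-cancelʳ-< (s * s) (loss t) (count W′) (begin-strict
      loss t + s * s            <⟨ large ⟩
      count W                   ≤⟨ sum-mono kept-or-hit ⟩
      (sum λ v → ⟦ W′ v ⟧ + hits v) ≡⟨ ∑-distrib-+ (λ v → ⟦ W′ v ⟧) hits ⟩
      count W′ + sum hits       ≡⟨ cong (count W′ +_) total-hits ⟩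
      count W′ + s * s          ∎)

    chain-W′ : ∃ λ (y : Fin t → Fin n) → IsChain _⇒_ y × (∀ j → T (W′ (y j)))
    chain-W′ = chain-within _⇒_ ⇒-total t W′ W′-large

    in-W′ : ∀ j → T (W′ (proj₁ chain-W′ j))
    in-W′ = proj₂ (proj₂ chain-W′)

  -- The hypothesis bounds the sum `Z` of `s`-th powers of excess in-degrees, the power mean turns
  -- this into a bound on their sum `Y`, and `k ≤ b * n + Y`. Raising to the power `s` avoids the
  -- exponent `2 − 1/s`.
  colours-upper : ∀ s M → 1 ≤ s → 1 ≤ n → (sum λ v → chains _⇒_ s (inArc v)) ≤ M * n ^ s →
    k ^ s ≤ (2 * (factor s * M + loss s)) ^ s * n ^ (2 * s ∸ 1)
  colours-upper s@(suc r) M _ 1≤n few = bound (≤-total Y (b * n))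
    where
    open ≤-Reasoning
    a b e : ℕ
    a = factor s
    b = loss s
    e = 2 * s ∸ 1
    y : Fin n → ℕ
    y v = count (inArc v) ∸ b
    Y Z : ℕ
    Y = sum y
    Z = sum λ v → y v ^ s

    instance
      n≢0 : NonZero n
      n≢0 = >-nonZero 1≤n

    k≤ : k ≤ b * n + Y
    k≤ = begin
      k                                     ≤⟨ colours≤arcs ⟩
      (sum λ v → count (inArc v))           ≤⟨ sum-mono (λ v → m≤n+m∸n (count (inArc v)) b) ⟩
      (sum λ v → b + y v)                   ≡⟨ ∑-distrib-+ (λ _ → b) y ⟩
      (sum {n} λ _ → b) + Y                 ≡⟨ cong (_+ Y) (trans (sum-const n b) (*-comm n b)) ⟩
      b * n + Y                             ∎

    mean : Y ^ s * n ≤ n ^ s * Z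
    mean = subst₂ _≤_
      (cong₂ (λ Y n → Y ^ s * n) (sum-cong-≗ λ v → trans (+-identityʳ _) (*-identityʳ (y v))) mass)
      (cong₂ (λ n Z → n ^ s * Z) mass (sum-cong-≗ λ v → +-identityʳ (y v ^ s)))
      (power-mean (λ _ → 1) y s)
      where
      mass : (sum λ v → 1 * y v ^ 0) ≡ n
      mass = trans (sum-const n 1) (*-identityʳ n)

    Z≤ : Z ≤ a * (M * n ^ s)
    Z≤ = begin
      Z ≤⟨ sum-mono (λ v → chains-lower _⇒_ ⇒-total s (inArc v)) ⟩
      (sum λ v → a * chains _⇒_ s (inArc v))    ≡⟨ *-distribˡ-sum a (λ v → chains _⇒_ s (inArc v)) ⟨
      a * (sum λ v → chains _⇒_ s (inArc v))    ≤⟨ *-monoʳ-≤ a few ⟩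
      a * (M * n ^ s)                           ∎

    Y^s≤ : Y ^ s ≤ a * M * n ^ e
    Y^s≤ = *-cancelʳ-≤ (Y ^ s) (a * M * n ^ e) n (begin
      Y ^ s * n                 ≤⟨ mean ⟩
      n ^ s * Z                 ≤⟨ *-monoʳ-≤ (n ^ s) Z≤ ⟩
      n ^ s * (a * (M * n ^ s)) ≡⟨ gather (n ^ s) a M ⟩
      a * M * (n ^ s * n ^ s)   ≡⟨ cong (a * M *_) (trans (sym (^-distribˡ-+-* n s s))
                                                    (cong (λ m → n ^ (s + m)) (sym (+-identityʳ s)))) ⟩
      a * M * (n * n ^ e)       ≡⟨ shuffle (a * M) n (n ^ e) ⟩
      a * M * n ^ e * n         ∎)
      where
      gather : ∀ p a M → p * (a * (M * p)) ≡ a * M * (p * p)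
      gather = solve-∀
      shuffle : ∀ a n p → a * (n * p) ≡ a * p * n
      shuffle = solve-∀

    m≤m^s : ∀ m → m ≤ m ^ s
    m≤m^s zero    = z≤n
    m≤m^s (suc m) = m≤m*n (suc m) (suc m ^ r) {{m^n≢0 (suc m) r}}

    bound : Y ≤ b * n ⊎ b * n ≤ Y → k ^ s ≤ (2 * (a * M + b)) ^ s * n ^ e
    bound (inj₁ Y≤bn) = begin
      k ^ s                             ≤⟨ ^-monoˡ-≤ s (≤-trans k≤ (+-monoʳ-≤ (b * n) Y≤bn)) ⟩
      (b * n + b * n) ^ s               ≡⟨ cong (_^ s) (double b n) ⟩
      (2 * b * n) ^ s                   ≡⟨ ^-distribʳ-* s (2 * b) n ⟩
      (2 * b) ^ s * n ^ s               ≤⟨ *-mono-≤ (^-monoˡ-≤ s (*-monoʳ-≤ 2 (m≤n+m b (a * M))))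
                                             (^-monoʳ-≤ n (≤-trans (m≤n+m s r)
                                               (≤-reflexive (cong (r +_) (sym (+-identityʳ s)))))) ⟩
      (2 * (a * M + b)) ^ s * n ^ e     ∎
      where
      double : ∀ b n → b * n + b * n ≡ 2 * b * n
      double = solve-∀
    -- The constant `a * M` is weakened to its own `s`-th power so that it can be merged into the
    -- base.
    bound (inj₂ bn≤Y) = begin
      k ^ s                             ≤⟨ ^-monoˡ-≤ s (≤-trans k≤ (+-monoˡ-≤ Y bn≤Y)) ⟩
      (Y + Y) ^ s                       ≡⟨ cong (λ z → (Y + z) ^ s) (+-identityʳ Y) ⟨
      (2 * Y) ^ s                       ≡⟨ ^-distribʳ-* s 2 Y ⟩
      2 ^ s * Y ^ s                     ≤⟨ *-monoʳ-≤ (2 ^ s) Y^s≤ ⟩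
      2 ^ s * (a * M * n ^ e)           ≡⟨ *-assoc (2 ^ s) (a * M) (n ^ e) ⟨
      2 ^ s * (a * M) * n ^ e           ≤⟨ *-monoˡ-≤ (n ^ e) (*-monoʳ-≤ (2 ^ s)
                                             (≤-trans (m≤m^s (a * M)) (^-monoˡ-≤ s (m≤m+n (a * M) b)))) ⟩
      2 ^ s * (a * M + b) ^ s * n ^ e   ≡⟨ cong (_* n ^ e) (^-distribʳ-* s 2 (a * M + b)) ⟨
      (2 * (a * M + b)) ^ s * n ^ e     ∎

largest-elim : ∀ {P : ℕ → Set} (Q : ℕ → Set) (P? : ∀ m → Dec (P m)) →
  Q 0 → (∀ m → P m → Q m) → ∀ b → Q (largest P? b)
largest-elim Q P? Q0 P⇒Q zero    = Q0
largest-elim Q P? Q0 P⇒Q (suc b) with P? (suc b)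
... | yes p = P⇒Q (suc b) p
... | no  _ = largest-elim Q P? Q0 P⇒Q b

-- The base in `colours-upper` at `M = loss t + s * s`, the threshold of `rainbow-join`.
constant : ℕ → ℕ → ℕ
constant s t = 2 * (factor s * (loss t + s * s) + loss s)

ar⋆-upper : ∀ {s t} (T₁ : Graph s) (T₂ : Graph t) → ¬ Cycle T₁ → ¬ Cycle T₂ → 1 ≤ s →
  ∀ n → 1 ≤ n → ar⋆ n (join T₁ T₂) ^ s ≤ constant s t ^ s * n ^ (2 * s ∸ 1)
ar⋆-upper {suc r} {t} T₁ T₂ acyclic₁ acyclic₂ 1≤s n 1≤n =
  largest-elim (λ a → a ^ suc r ≤ constant (suc r) t ^ suc r * n ^ (2 * suc r ∸ 1))
    (rainbowFreeWithColours? n (join T₁ T₂)) z≤n bounded (n * n)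
  where
  bounded : ∀ k → RainbowFreeWithColours n (join T₁ T₂) k →
    k ^ suc r ≤ constant (suc r) t ^ suc r * n ^ (2 * suc r ∸ 1)
  bounded k (χ , rainbow-free) = colours-upper (suc r) (loss t + suc r * suc r) 1≤s 1≤n
    (≮⇒≥ (rainbow-free ∘ rainbow-join T₁ T₂ acyclic₁ acyclic₂))
    where open Arcs χ

-- Lower bound: counting edges and large cuts.

length-filter-tabulate : ∀ {A : Set} {P : A → Set} (P? : ∀ x → Dec (P x)) {n} (f : Fin n → A) →
  length (filter P? (tabulate f)) ≡ count (λ i → does (P? (f i)))
length-filter-tabulate P? {zero}  f = refl
length-filter-tabulate P? {suc n} f with does (P? (f zero))
... | true  = cong suc (length-filter-tabulate P? (f ∘ suc))
... | false = length-filter-tabulate P? (f ∘ suc)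

length-filter-product : ∀ {A B : Set} {P : A × B → Set} (P? : ∀ x → Dec (P x)) {m n}
  (f : Fin m → A) (g : Fin n → B) →
  length (filter P? (cartesianProduct (tabulate f) (tabulate g))) ≡
  sum λ i → count λ j → does (P? (f i , g j))
length-filter-product P? {zero}  f g = refl
length-filter-product P? {suc m} f g = begin
  length (filter P? (map (f zero ,_) (tabulate g) ++ rest))
    ≡⟨ cong length (filter-++ P? (map (f zero ,_) (tabulate g)) rest) ⟩
  length (filter P? (map (f zero ,_) (tabulate g)) ++ filter P? rest)
    ≡⟨ length-++ (filter P? (map (f zero ,_) (tabulate g))) ⟩
  length (filter P? (map (f zero ,_) (tabulate g))) + length (filter P? rest)
    ≡⟨ cong₂ _+_ (trans (cong (length ∘ filter P?) (map-tabulate g (f zero ,_)))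
                        (length-filter-tabulate P? (λ j → f zero , g j)))
                 (length-filter-product P? (f ∘ suc) g) ⟩
  (count λ j → does (P? (f zero , g j))) + (sum λ i → count λ j → does (P? (f (suc i) , g j))) ∎
  where
  open ≡-Reasoning
  rest = cartesianProduct (tabulate (f ∘ suc)) (tabulate g)

pairs : ∀ {n} → (Fin n → Fin n → Bool) → ℕ
pairs {zero}  a = 0
pairs {suc n} a = count (λ j → a zero (suc j)) + pairs (λ i j → a (suc i) (suc j))

pairs-sum : ∀ {n} (a : Fin n → Fin n → Bool) →
  (sum λ i → count λ j → does (i <ᶠ? j) ∧ a i j) ≡ pairs a
pairs-sum {zero}  a = refl
pairs-sum {suc n} a = cong (count (λ j → a zero (suc j)) +_) (pairs-sum (λ i j → a (suc i) (suc j)))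

edges-pairs : ∀ {n} (G : Graph n) → edges G ≡ pairs (adj G)
edges-pairs G = trans (length-filter-product (increasingEdge? G) id id) (pairs-sum (adj G))

-- Vertices are placed one by one, each on the side that cuts at least half of
-- its edges to the vertices already placed.
large-cut : ∀ {n} (a : Fin n → Fin n → Bool) →
  ∃ λ (side : Fin n → Bool) → pairs a ≤ 2 * pairs (λ i j → a i j ∧ (side i xor side j))
large-cut {zero}  a = (λ ()) , z≤n
large-cut {suc n} a with large-cut (λ i j → a (suc i) (suc j))
... | side , half = choose (≤-total (count right) (count left))
  where
  open ≤-Reasoning
  left right : Fin n → Bool
  left  j = a zero (suc j) ∧ side j
  right j = a zero (suc j) ∧ not (side j)

  cut : ℕ
  cut = pairs (λ i j → a (suc i) (suc j) ∧ (side i xor side j))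

  split : ∀ b c → ⟦ b ⟧ ≡ ⟦ b ∧ c ⟧ + ⟦ b ∧ not c ⟧
  split false c     = refl
  split true  true  = refl
  split true  false = refl

  degree : count (λ j → a zero (suc j)) ≡ count left + count right
  degree = trans (sum-cong-≗ λ j → split (a zero (suc j)) (side j))
                 (∑-distrib-+ (λ j → ⟦ left j ⟧) (λ j → ⟦ right j ⟧))

  bound : ∀ x → count left + count right ≤ x + x → pairs a ≤ 2 * (x + cut)
  bound x le = begin
    count (λ j → a zero (suc j)) + pairs (λ i j → a (suc i) (suc j))
      ≤⟨ +-mono-≤ (≤-trans (≤-reflexive degree) le) half ⟩
    x + x + 2 * cut   ≡⟨ double x cut ⟩
    2 * (x + cut)     ∎
    where
    double : ∀ x c → x + x + 2 * c ≡ 2 * (x + c)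
    double = solve-∀

  choose : count right ≤ count left ⊎ count left ≤ count right →
    ∃ λ (side : Fin (suc n) → Bool) → pairs a ≤ 2 * pairs (λ i j → a i j ∧ (side i xor side j))
  choose (inj₁ r≤l) = false Vector.∷ side , bound (count left) (+-monoʳ-≤ (count left) r≤l)
  choose (inj₂ l≤r) = true  Vector.∷ side , bound (count right) (+-monoˡ-≤ (count right) l≤r)

cutGraph : ∀ {n} → Graph n → (Fin n → Bool) → Graph n
cutGraph G side = mkGraph (λ i j → adj G i j ∧ (side i xor side j))
  (λ i j → cong₂ _∧_ (adj-sym G i j) (xor-comm (side i) (side j)))
  (λ i → trans (cong (adj G i i ∧_) (xor-same (side i))) (∧-zeroʳ (adj G i i)))

xor⇒≢ : ∀ {a b} → T (a xor b) → a ≢ b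
xor⇒≢ {true}  xor refl = xor
xor⇒≢ {false} xor refl = xor

-- Lower bound: the colouring.

lookup-injective : ∀ {A : Set} {xs : List A} → Unique xs → Injective _≡_ _≡_ (lookup xs)
lookup-injective (x∉ ∷ u) {zero}  {zero}  _  = refl
lookup-injective {xs = _ ∷ xs} (x∉ ∷ u) {zero}  {suc j} eq =
  contradiction eq (All.lookup x∉ (∈-lookup {xs = xs} j))
lookup-injective {xs = _ ∷ xs} (x∉ ∷ u) {suc i} {zero}  eq =
  contradiction (sym eq) (All.lookup x∉ (∈-lookup {xs = xs} i))
lookup-injective (x∉ ∷ u) {suc i} {suc j} eq = cong suc (lookup-injective u eq)

-- Serves to renumber colours: a star-colouring must attain every colour, so `f` is factored through
-- the set of its values.
record Image {n N : ℕ} (f : Fin n → Fin n → Fin N) : Set where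
  field
    size       : ℕ
    encode     : Fin n → Fin n → Fin size
    decode     : Fin size → Fin N
    decode-enc : ∀ i j → decode (encode i j) ≡ f i j
    decode-inj : Injective _≡_ _≡_ decode
    onto       : ∀ c → ∃₂ λ i j → encode i j ≡ c

abstract
  image : ∀ {n N} (f : Fin n → Fin n → Fin N) → Image f
  image {n} {N} f = record
    { size       = length values
    ; encode     = λ i j → index (value i j)
    ; decode     = lookup values
    ; decode-enc = λ i j → sym (lookup-index (value i j))
    ; decode-inj = decode-inj
    ; onto       = λ c →
        let i , j , fij≡ = proj₂ (∈-filter⁻ isValue? {xs = allFin N} (∈-lookup {xs = values} c))
        in i , j , decode-inj (trans (sym (lookup-index (value i j))) fij≡)
    }
    where
    isValue? : ∀ c → Dec (∃₂ λ i j → f i j ≡ c)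
    isValue? c = any? λ i → any? λ j → f i j ≟ c

    values : List (Fin N)
    values = filter isValue? (allFin N)

    decode-inj : Injective _≡_ _≡_ (lookup values)
    decode-inj = lookup-injective (Unique.filter⁺ isValue? (Unique.allFin⁺ N))

    value : ∀ i j → f i j ∈ values
    value i j = ∈-filter⁺ isValue? (∈-allFin (f i j)) (i , j , refl)

-- Every edge of C gets a colour of its own; any other pair i < j is coloured by i.
module MinColouring {m : ℕ} (C : Graph (2 + m)) where

  private
    n : ℕ
    n = 2 + m

  enc : Fin n → Fin n → Fin (n * suc n)
  enc i j = combine {n} {suc n} i (if adj C i j then suc j else zero)

  -- The diagonal must not introduce an otherwise unused colour.
  code : Fin n → Fin n → Fin (n * suc n)
  code i j with <ᶠ-cmp i j
  ... | tri< _ _ _ = enc i j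
  ... | tri≈ _ _ _ = enc zero (suc zero)
  ... | tri> _ _ _ = enc j i

  code-< : ∀ {i j} → i Fin.< j → code i j ≡ enc i j
  code-< {i} {j} i<j with <ᶠ-cmp i j
  ... | tri< _ _ _    = refl
  ... | tri≈ _ refl _ = contradiction i<j (<ᶠ-irrefl refl)
  ... | tri> _ _ j<i  = contradiction i<j (<ᶠ-asym j<i)

  code-> : ∀ {i j} → j Fin.< i → code i j ≡ enc j i
  code-> {i} {j} j<i with <ᶠ-cmp i j
  ... | tri< i<j _ _  = contradiction i<j (<ᶠ-asym j<i)
  ... | tri≈ _ refl _ = contradiction j<i (<ᶠ-irrefl refl)
  ... | tri> _ _ _    = refl

  code-diagonal : ∀ i → code i i ≡ code zero (suc zero)
  code-diagonal i with <ᶠ-cmp i i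
  ... | tri< i<i _ _ = contradiction i<i (<ᶠ-irrefl refl)
  ... | tri≈ _ _ _   = refl
  ... | tri> _ _ i<i = contradiction i<i (<ᶠ-irrefl refl)

  code-sym : ∀ i j → i ≢ j → code i j ≡ code j i
  code-sym i j i≢j with <ᶠ-cmp i j
  ... | tri< i<j _ _ = sym (code-> i<j)
  ... | tri≈ _ i≡j _ = contradiction i≡j i≢j
  ... | tri> _ _ j<i = sym (code-< j<i)

  open Image (image code) public

  encode-cong : ∀ {i j i′ j′} → code i j ≡ code i′ j′ → encode i j ≡ encode i′ j′
  encode-cong eq = decode-inj (trans (decode-enc _ _) (trans eq (sym (decode-enc _ _))))

  encode-code : ∀ {i j c} → encode i j ≡ c → code i j ≡ decode c
  encode-code eq = trans (sym (decode-enc _ _)) (cong decode eq)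

  minColouring : StarColouring n size
  minColouring = record
    { colour     = encode
    ; colour-sym = λ i j i≢j → encode-cong (code-sym i j i≢j)
    ; used       = used′
    -- Private and shared codes alike have the smaller endpoint as first coordinate, which can
    -- therefore be taken as the centre.
    ; star       = λ c → proj₁ (remQuot {n} (suc n) (decode c)) , centred c
    }
    where
    used′ : ∀ c → ∃₂ λ i j → i ≢ j × encode i j ≡ c
    used′ c with onto c
    ... | i , j , ij≡c with i ≟ j
    ...   | no  i≢j  = i , j , i≢j , ij≡c
    ...   | yes refl = zero , suc zero , (λ ()) , trans (encode-cong (sym (code-diagonal i))) ij≡c

    first : ∀ {i j c} → enc i j ≡ decode c → i ≡ proj₁ (remQuot {n} (suc n) (decode c))
    first {i} eq = trans
      (sym (cong proj₁ (remQuot-combine {n} {suc n} i _)))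
      (cong (proj₁ ∘ remQuot {n} (suc n)) eq)

    centred : ∀ c i j → i ≢ j → encode i j ≡ c →
      i ≡ proj₁ (remQuot {n} (suc n) (decode c)) ⊎ j ≡ proj₁ (remQuot {n} (suc n) (decode c))
    centred c i j i≢j eq with <ᶠ-cmp i j
    ... | tri< i<j _ _ = inj₁ (first {i} {j} (trans (sym (code-< i<j)) (encode-code eq)))
    ... | tri≈ _ i≡j _ = contradiction i≡j i≢j
    ... | tri> _ _ j<i = inj₂ (first {j} {i} (trans (sym (code-> j<i)) (encode-code eq)))

  enc-edge : ∀ {i j} → Adj C i j → enc i j ≡ combine {n} {suc n} i (suc j)
  enc-edge {i} {j} ij with adj C i j
  ... | true = refl

  enc-nonedge : ∀ {i j} → ¬ Adj C i j → enc i j ≡ combine {n} {suc n} i zero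
  enc-nonedge {i} {j} ¬ij with adj C i j
  ... | true  = contradiction _ ¬ij
  ... | false = refl

  edges≤size : edges C ≤ size
  edges≤size = injective⇒≤ {f = uncurry encode ∘ lookup edgeList} λ {k} {l} eq →
    lookup-injective unique (same (isEdge k) (isEdge l)
      (trans (encode-code eq) (decode-enc _ _)))
    where
    edgeList : List (Fin n × Fin n)
    edgeList = filter (increasingEdge? C) (cartesianProduct (allFin n) (allFin n))

    unique : Unique edgeList
    unique = Unique.filter⁺ (increasingEdge? C)
      (Unique.cartesianProduct⁺ (Unique.allFin⁺ n) (Unique.allFin⁺ n))

    isEdge : ∀ k → IncreasingEdge C (lookup edgeList k)
    isEdge k = proj₂ (∈-filter⁻ (increasingEdge? C) {xs = cartesianProduct (allFin n) (allFin n)}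
                       (∈-lookup {xs = edgeList} k))

    same : ∀ {e e′} → IncreasingEdge C e → IncreasingEdge C e′ → uncurry code e ≡ uncurry code e′ → e ≡ e′
    same {i , j} {i′ , j′} (i<j , ij) (i<j′ , ij′) eq =
      let i≡ , j≡ = combine-injective {n} {suc n} i (suc j) i′ (suc j′)
            (trans (sym (enc-edge ij)) (trans (sym (code-< i<j))
              (trans eq (trans (code-< i<j′) (enc-edge ij′)))))
      in cong₂ _,_ i≡ (suc-injective j≡)

  -- Because of this, a rainbow copy has at most one edge outside `C` going up from each vertex, as
  -- `up` demands in `CopyOutside`.
  nonedges-same-colour : ∀ {i j l} → i Fin.< j → i Fin.< l → ¬ Adj C i j → ¬ Adj C i l →
    colour minColouring i j ≡ colour minColouring i l
  nonedges-same-colour i<j i<l ¬ij ¬il = encode-cong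
    (trans (code-< i<j) (trans (enc-nonedge ¬ij) (sym (trans (code-< i<l) (enc-nonedge ¬il)))))

-- Lower bound: forests with unique upward edges.

first-step : ∀ {n} (G : Graph n) {i j} → Star (Adj G) i j → i ≢ j → ∃ (Adj G i)
first-step G ε        i≢i = contradiction refl i≢i
first-step G (ik ◅ _) _   = _ , ik

neighbour : ∀ {n} (G : Graph (2 + n)) → Connected G → ∀ i → ∃ (Adj G i)
neighbour G connected i = first-step G (connected i (punchIn i zero)) (punchInᵢ≢i i zero ∘ sym)

transpose-injective : ∀ {n} (i j : Fin n) → Injective _≡_ _≡_ (transpose i j)
transpose-injective i j eq =
  trans (sym (transpose-inverse j i)) (trans (cong (transpose j i) eq) (transpose-inverse j i))

≢⇒≡ : ∀ {a b c : Bool} → a ≢ c → b ≢ c → a ≡ b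
≢⇒≡ {true}  {true}          _   _   = refl
≢⇒≡ {false} {false}         _   _   = refl
≢⇒≡ {true}  {false} {true}  a≢c _   = contradiction refl a≢c
≢⇒≡ {true}  {false} {false} _   b≢c = contradiction refl b≢c
≢⇒≡ {false} {true}  {true}  _   b≢c = contradiction refl b≢c
≢⇒≡ {false} {true}  {false} a≢c _   = contradiction refl a≢c

-- A graph in which every vertex has at most one neighbour further up is a forest.
module UpForest {V : Set} {n : ℕ} (rank : V → Fin n) (rank-injective : Injective _≡_ _≡_ rank)
  (R : V → V → Set) (R-sym : ∀ {p q} → R p q → R q p) (R-irrefl : ∀ {p} → ¬ R p p)
  (up : ∀ {p q r} → R p q → R p r → rank p Fin.< rank q → rank p Fin.< rank r → q ≡ r) where

  compare : ∀ {p q} → R p q → rank p Fin.< rank q ⊎ rank q Fin.< rank p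
  compare {p} {q} pq with <ᶠ-cmp (rank p) (rank q)
  ... | tri< p<q _ _ = inj₁ p<q
  ... | tri≈ _ p≡q _ = contradiction (subst (R p) (sym (rank-injective p≡q)) pq) R-irrefl
  ... | tri> _ _ q<p = inj₂ q<p

  one-down : ∀ {p q r} → R p q → R p r → q ≢ r → rank q Fin.< rank p ⊎ rank r Fin.< rank p
  one-down pq pr q≢r with compare pq | compare pr
  ... | inj₂ q<p | _        = inj₁ q<p
  ... | inj₁ _   | inj₂ r<p = inj₂ r<p
  ... | inj₁ p<q | inj₁ p<r = contradiction (up pq pr p<q p<r) q≢r

  -- A walk without turning back that has once gone down keeps going down, since each vertex has at
  -- most one upward edge.
  keep-down : ∀ {p q r} → R p q → R p r → q ≢ r → rank p Fin.< rank q → rank r Fin.< rank p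
  keep-down pq pr q≢r p<q with one-down pq pr q≢r
  ... | inj₁ q<p = contradiction p<q (<ᶠ-asym q<p)
  ... | inj₂ r<p = r<p

  -- From `p`, one of the two directions round the triangle goes down; by `keep-down` it leads down
  -- all the way back to `p`.
  no-triangle : ∀ {p q r} → R p q → R q r → R r p → ⊥
  no-triangle pq qr rp with one-down pq (R-sym rp) (λ { refl → R-irrefl qr })
  ... | inj₁ q<p =
    let r<q = keep-down (R-sym pq) qr (λ { refl → R-irrefl rp }) q<p
        p<r = keep-down (R-sym qr) rp (λ { refl → R-irrefl pq }) r<q
    in <ᶠ-asym p<r (<ᶠ-trans r<q q<p)
  ... | inj₂ r<p =
    let q<r = keep-down rp (R-sym qr) (λ { refl → R-irrefl pq }) r<p
        p<q = keep-down qr (R-sym pq) (λ { refl → R-irrefl rp }) q<r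
    in <ᶠ-asym p<q (<ᶠ-trans q<r r<p)

  no-square : ∀ {p q r s} → R p q → R q r → R r s → R s p → p ≢ r → q ≢ s → ⊥
  no-square pq qr rs sp p≢r q≢s with one-down pq (R-sym sp) q≢s
  ... | inj₁ q<p =
    let r<q = keep-down (R-sym pq) qr p≢r q<p
        s<r = keep-down (R-sym qr) rs q≢s r<q
        p<s = keep-down (R-sym rs) sp (p≢r ∘ sym) s<r
    in <ᶠ-asym p<s (<ᶠ-trans s<r (<ᶠ-trans r<q q<p))
  ... | inj₂ s<p =
    let r<s = keep-down sp (R-sym rs) p≢r s<p
        q<r = keep-down rs (R-sym qr) (q≢s ∘ sym) r<s
        p<q = keep-down qr (R-sym pq) (p≢r ∘ sym) q<r
    in <ᶠ-asym p<q (<ᶠ-trans q<r (<ᶠ-trans r<s s<p))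

  Linked : {I : Set} → (I → V) → Set
  Linked P = Injective _≡_ _≡_ P × (∀ i j → Star (λ i j → R (P i) (P j)) i j)

  -- If P i has an upward neighbour outside P, then following upward edges inside P
  -- from any vertex leads to P i.
  module _ {I : Set} {P : I → V} (linked : Linked P) {i : I} {w : V}
           (iw : R (P i) w) (i<w : rank (P i) Fin.< rank w) (w∉P : ∀ j → P j ≢ w) where

    data Climbs : I → Set where
      here : Climbs i
      step : ∀ {j k} → R (P j) (P k) → rank (P j) Fin.< rank (P k) → Climbs k → Climbs j

    -- Moving down to `k` extends the climb. A move up must follow the unique upward edge: from
    -- `P i` that edge leads to `w`, outside `P`, and elsewhere it is the next edge of the climb.
    climbs-next : ∀ {j k} → R (P j) (P k) → Climbs j → Climbs k
    climbs-next jk climbs with compare jk | climbs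
    ... | inj₂ k<j | _              = step (R-sym jk) k<j climbs
    ... | inj₁ i<k | here           = contradiction (up jk iw i<k i<w) (w∉P _)
    ... | inj₁ j<k | step jl j<l cl = subst Climbs (proj₁ linked (up jl jk j<l j<k)) cl

    climbs-all : ∀ {j k} → Star (λ i j → R (P i) (P j)) j k → Climbs j → Climbs k
    climbs-all ε         c = c
    climbs-all (jl ◅ lk) c = climbs-all lk (climbs-next jl c)

    climbs-≤ : ∀ {j} → Climbs j → rank (P j) Fin.≤ rank (P i)
    climbs-≤ here            = ≤-refl
    climbs-≤ (step _ j<k ck) = ≤-trans (<⇒≤ j<k) (climbs-≤ ck)

    top : ∀ j → rank (P j) Fin.≤ rank (P i)
    top j = climbs-≤ (climbs-all (proj₂ linked i j) here)

  module _ {I J : Set} {P : I → V} {Q : J → V} (P-linked : Linked P) (Q-linked : Linked Q)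
           (disjoint : ∀ i j → P i ≢ Q j) where

    -- By `top`, the lower end of a cross edge is the highest vertex of its set. Two upward edges
    -- from `P` thus share their lower end and coincide by `up`; an upward edge from `P` together
    -- with one from `Q` makes the ranks run in a circle.
    cross-from-below : ∀ {i i′ j j′} → R (P i) (Q j) → rank (P i) Fin.< rank (Q j) →
      R (P i′) (Q j′) → i ≡ i′ × j ≡ j′
    cross-from-below {i} {i′} {j} {j′} ij i<j ij′ with compare ij′
    ... | inj₁ i′<j′ with proj₁ P-linked (rank-injective (≤ᶠ-antisym
            (top P-linked ij′ i′<j′ (λ k → disjoint k j′) i) (top P-linked ij i<j (λ k → disjoint k j) i′)))
    ...   | refl = refl , proj₁ Q-linked (up ij ij′ i<j i′<j′)
    cross-from-below {i} {i′} {j} {j′} ij i<j ij′ | inj₂ j′<i′ = contradiction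
      (<-≤-trans i<j (≤-trans (top Q-linked (R-sym ij′) j′<i′ (λ k → disjoint i′ k ∘ sym) j)
        (≤-trans (<⇒≤ j′<i′) (top P-linked ij i<j (λ k → disjoint k j) i′))))
      (<-irrefl refl)

  unique-cross : ∀ {I J : Set} {P : I → V} {Q : J → V} → Linked P → Linked Q → (∀ i j → P i ≢ Q j) →
    ∀ {i i′ j j′} → R (P i) (Q j) → R (P i′) (Q j′) → i ≡ i′ × j ≡ j′
  unique-cross P-linked Q-linked disjoint ij ij′ with compare ij
  ... | inj₁ i<j = cross-from-below P-linked Q-linked disjoint ij i<j ij′
  ... | inj₂ j<i =
    let j≡ , i≡ = cross-from-below Q-linked P-linked (λ j i → disjoint i j ∘ sym) (R-sym ij) j<i (R-sym ij′)
    in i≡ , j≡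

  linked-by-hub : ∀ {k} {P : Fin k → V} → Injective _≡_ _≡_ P → (u : Fin k) →
    (∀ i → i ≢ u → R (P i) (P u)) → Linked P
  linked-by-hub {P = P} inj u spoke = inj , λ i j → to i (from j)
    where
    from : ∀ j → Star (λ i j → R (P i) (P j)) u j
    from j with j ≟ u
    ... | yes refl = ε
    ... | no  j≢u  = R-sym (spoke j j≢u) ◅ ε
    to : ∀ i {j} → Star (λ i j → R (P i) (P j)) u j → Star (λ i j → R (P i) (P j)) i j
    to i path with i ≟ u
    ... | yes refl = path
    ... | no  i≢u  = spoke i i≢u ◅ path

-- Lower bound: finding `K⁻` in the cut graph.

-- Transpositions move the only possible gap to the pair `zero`, `zero`, where `K⁻` lacks its edge;
-- if no pair is missing, that pair itself is declared the gap.
almost-complete⇒K⁻ : ∀ {s t n} (C : Graph n) (P : Fin (suc s) → Fin n) (Q : Fin (suc t) → Fin n) →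
  Injective _≡_ _≡_ P → Injective _≡_ _≡_ Q → (∀ i j → P i ≢ Q j) →
  (∀ {i i′ j j′} → ¬ Adj C (P i) (Q j) → ¬ Adj C (P i′) (Q j′) → i ≡ i′ × j ≡ j′) →
  K⁻ (suc s) (suc t) ⊑ C
almost-complete⇒K⁻ {s} {t} {n} C P Q P-inj Q-inj disjoint unique = h ∘ splitAt (suc s) ,
  (λ eq → splitAt-injective (suc s) (h-inj _ _ eq)) ,
  λ u v → h-hom (splitAt (suc s) u) (splitAt (suc s) v)
  where
  gap : ∃₂ λ i₀ j₀ → ∀ i j → ¬ (i ≡ i₀ × j ≡ j₀) → Adj C (P i) (Q j)
  gap with any? (λ i → any? λ j → ¬? (T? (adj C (P i) (Q j))))
  ... | yes (i₀ , j₀ , ¬ij₀) = i₀ , j₀ , λ i j other → elsewhere i j other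
    where
    elsewhere : ∀ i j → ¬ (i ≡ i₀ × j ≡ j₀) → Adj C (P i) (Q j)
    elsewhere i j other with T? (adj C (P i) (Q j))
    ... | yes ij = ij
    ... | no ¬ij = contradiction (unique ¬ij ¬ij₀) other
  ... | no full = zero , zero , λ i j _ → everywhere i j
    where
    everywhere : ∀ i j → Adj C (P i) (Q j)
    everywhere i j with T? (adj C (P i) (Q j))
    ... | yes ij = ij
    ... | no ¬ij = contradiction (i , j , ¬ij) full

  i₀ : Fin (suc s)
  i₀ = proj₁ gap
  j₀ : Fin (suc t)
  j₀ = proj₁ (proj₂ gap)

  h : Fin (suc s) ⊎ Fin (suc t) → Fin n
  h (inj₁ i) = P (transpose zero i₀ i)
  h (inj₂ j) = Q (transpose zero j₀ j)

  h-inj : ∀ p q → h p ≡ h q → p ≡ q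
  h-inj (inj₁ i) (inj₁ l) eq = cong inj₁ (transpose-injective zero i₀ (P-inj eq))
  h-inj (inj₁ i) (inj₂ j) eq = contradiction eq (disjoint _ _)
  h-inj (inj₂ j) (inj₁ i) eq = contradiction (sym eq) (disjoint _ _)
  h-inj (inj₂ j) (inj₂ l) eq = cong inj₂ (transpose-injective zero j₀ (Q-inj eq))

  present : ∀ i j → T (not (missing (suc s) (suc t) i j)) → Adj C (h (inj₁ i)) (h (inj₂ j))
  present i j ok = proj₂ (proj₂ gap) _ _ λ (i≡ , j≡) →
    subst T (cong₂ (λ i j → not (missing (suc s) (suc t) i j))
      (transpose-injective zero i₀ {i} {zero} i≡) (transpose-injective zero j₀ {j} {zero} j≡)) ok

  h-hom : ∀ p q → T (K⁻Adj (suc s) (suc t) p q) → Adj C (h p) (h q)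
  h-hom (inj₁ i) (inj₂ j) ok = present i j ok
  h-hom (inj₂ j) (inj₁ i) ok = Adj-sym C (present i j ok)

-- The edges of the copy outside the bipartite graph C form an up-forest.  As it
-- contains every edge of the copy within a side of C, each side receives a set
-- inducing a tree of the copy, of sizes s and t: either V(T₁) and V(T₂), or, when
-- both trees are stars, these sets with the two centres exchanged.
module CopyOutside {s t n : ℕ} (T₁ : Graph (3 + s)) (T₂ : Graph (3 + t))
  (conn₁ : Connected T₁) (conn₂ : Connected T₂)
  (C : Graph n) (side : Fin n → Bool) (bipartite : ∀ {i j} → Adj C i j → side i ≢ side j)
  (f : Fin (3 + s) ⊎ Fin (3 + t) → Fin n) (f-inj : Injective _≡_ _≡_ f)
  (up : ∀ {p q r} → T (joinAdj T₁ T₂ p q) → T (joinAdj T₁ T₂ p r) →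
     ¬ Adj C (f p) (f q) → ¬ Adj C (f p) (f r) → f p Fin.< f q → f p Fin.< f r → q ≡ r)
  where

  V : Set
  V = Fin (3 + s) ⊎ Fin (3 + t)

  H : V → V → Set
  H p q = T (joinAdj T₁ T₂ p q)

  R : V → V → Set
  R p q = H p q × ¬ Adj C (f p) (f q)

  σ : V → Bool
  σ = side ∘ f

  same-side : ∀ {p q} → H p q → σ p ≡ σ q → R p q
  same-side pq σ≡ = pq , λ pq∈C → bipartite pq∈C σ≡

  open UpForest f f-inj R
    (λ {p} {q} (pq , ¬pq) → subst T (joinAdj-sym T₁ T₂ p q) pq , ¬pq ∘ Adj-sym C)
    (λ {p} (pp , _) → subst T (joinAdj-irrefl T₁ T₂ p) pp)
    (λ (pq , ¬pq) (pr , ¬pr) → up pq pr ¬pq ¬pr)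

  -- All pairs between `P` and `Q` are edges of the copy, so a pair missing from `C` is a forest
  -- edge between two linked sets, and `unique-cross` allows only one.
  finish : (P : Fin (3 + s) → V) (Q : Fin (3 + t) → V) → Linked P → Linked Q →
    (∀ i j → P i ≢ Q j) → (∀ i j → H (P i) (Q j)) → K⁻ (3 + s) (3 + t) ⊑ C
  finish P Q P-linked Q-linked disjoint complete =
    almost-complete⇒K⁻ C (f ∘ P) (f ∘ Q) (proj₁ P-linked ∘ f-inj) (proj₁ Q-linked ∘ f-inj)
      (λ i j → disjoint i j ∘ f-inj)
      λ ¬ij ¬ij′ → unique-cross P-linked Q-linked disjoint (complete _ _ , ¬ij) (complete _ _ , ¬ij′)

  -- A vertex of `T₂` on the side of the edge would form a triangle of `R` with its two ends.
  off-edge₁ : ∀ {i l} → Adj T₁ i l → σ (inj₁ i) ≡ σ (inj₁ l) → ∀ j → σ (inj₂ j) ≢ σ (inj₁ i)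
  off-edge₁ il σ≡ j σj≡ = no-triangle (same-side il σ≡) (same-side _ (sym (trans σj≡ σ≡))) (same-side _ σj≡)

  off-edge₂ : ∀ {j m} → Adj T₂ j m → σ (inj₂ j) ≡ σ (inj₂ m) → ∀ i → σ (inj₁ i) ≢ σ (inj₂ j)
  off-edge₂ jm σ≡ i σi≡ = no-triangle (same-side jm σ≡) (same-side _ (sym (trans σi≡ σ≡))) (same-side _ σi≡)

  -- The edge keeps all of `T₂` off its side, so an edge of `T₂` lies within the opposite side and
  -- in turn keeps all of `T₁` off that one. Both trees are then linked by their own edges.
  monochromatic₁ : ∀ {i l} → Adj T₁ i l → σ (inj₁ i) ≡ σ (inj₁ l) → K⁻ (3 + s) (3 + t) ⊑ C
  monochromatic₁ {i} il σ≡ = finish inj₁ inj₂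
    (inj₁-injective , λ k l → Star.map (λ kl → same-side kl (≢⇒≡ (off₁ _) (off₁ _))) (conn₁ k l))
    (inj₂-injective , λ k l → Star.map (λ kl → same-side kl (≢⇒≡ (off₂ _) (off₂ _))) (conn₂ k l))
    (λ _ _ ()) (λ _ _ → _)
    where
    off₂ : ∀ j → σ (inj₂ j) ≢ σ (inj₁ i)
    off₂ = off-edge₁ il σ≡
    off₁ : ∀ k → σ (inj₁ k) ≢ σ (inj₂ zero)
    off₁ = off-edge₂ (proj₂ (neighbour T₂ conn₂ zero)) (≢⇒≡ (off₂ _) (off₂ _))

  monochromatic₂ : ∀ {j m} → Adj T₂ j m → σ (inj₂ j) ≡ σ (inj₂ m) → K⁻ (3 + s) (3 + t) ⊑ C
  monochromatic₂ jm σ≡ = monochromatic₁ (proj₂ (neighbour T₁ conn₁ zero))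
    (≢⇒≡ (off-edge₂ jm σ≡ _) (off-edge₂ jm σ≡ _))

  module Proper (proper₁ : ∀ {i l} → Adj T₁ i l → σ (inj₁ i) ≢ σ (inj₁ l))
                (proper₂ : ∀ {j m} → Adj T₂ j m → σ (inj₂ j) ≢ σ (inj₂ m)) where

    -- The four vertices would span a square of cross edges within one side.
    no-two-pairs : ∀ {i l j m} → i ≢ l → j ≢ m → σ (inj₁ i) ≡ σ (inj₁ l) →
      σ (inj₂ j) ≡ σ (inj₁ i) → σ (inj₂ m) ≡ σ (inj₁ i) → ⊥
    no-two-pairs i≢l j≢m il ji mi =
      no-square (same-side _ (sym ji)) (same-side _ (trans ji il)) (same-side _ (trans (sym il) (sym mi)))
        (same-side _ mi) (i≢l ∘ inj₁-injective) (j≢m ∘ inj₂-injective)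

    repeated : ∀ {k} (τ : Fin (3 + k) → Bool) → ∃₂ λ i l → i ≢ l × τ i ≡ τ l
    repeated τ with τ zero ≟ᵇ τ (suc zero) | τ zero ≟ᵇ τ (suc (suc zero))
    ... | yes eq | _      = zero , suc zero , (λ ()) , eq
    ... | no _   | yes eq = zero , suc (suc zero) , (λ ()) , eq
    ... | no ≢₁  | no ≢₂  = suc zero , suc (suc zero) , (λ ()) , ≢⇒≡ (≢₁ ∘ sym) (≢₂ ∘ sym)

    p q : Fin (3 + s)
    p = proj₁ (repeated (σ ∘ inj₁))
    q = proj₁ (proj₂ (repeated (σ ∘ inj₁)))

    p≢q : p ≢ q
    p≢q = proj₁ (proj₂ (proj₂ (repeated (σ ∘ inj₁))))

    -- A side holding two vertices of `T₁`; by `no-two-pairs` it holds at most one of `T₂`.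
    β : Bool
    β = σ (inj₁ p)

    pq : β ≡ σ (inj₁ q)
    pq = proj₂ (proj₂ (proj₂ (repeated (σ ∘ inj₁))))

    centre₂ : ∃ λ w → σ (inj₂ w) ≡ β
    centre₂ with neighbour T₂ conn₂ zero
    ... | m , 0m with σ (inj₂ zero) ≟ᵇ β
    ...   | yes eq = zero , eq
    ...   | no  ≢β = m , ≢⇒≡ (proper₂ 0m ∘ sym) (≢β ∘ sym)

    w : Fin (3 + t)
    w = proj₁ centre₂

    only-w : ∀ {j} → σ (inj₂ j) ≡ β → j ≡ w
    only-w {j} σj≡β with j ≟ w
    ... | yes j≡w = j≡w
    ... | no  j≢w = ⊥-elim (no-two-pairs p≢q j≢w pq σj≡β (proj₂ centre₂))

    off-w : ∀ {j} → j ≢ w → σ (inj₂ j) ≢ β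
    off-w j≢w = j≢w ∘ only-w

    -- `T₂` has at least three vertices, so two can be picked besides `w`. Both lie opposite `β`,
    -- which leaves room for only one vertex of `T₁` there.
    m₀ m₁ : Fin (3 + t)
    m₀ = punchIn w zero
    m₁ = punchIn w (suc zero)

    m₀≢m₁ : m₀ ≢ m₁
    m₀≢m₁ eq with punchIn-injective w zero (suc zero) eq
    ... | ()

    σm₀≢β : σ (inj₂ m₀) ≢ β
    σm₀≢β = off-w (punchInᵢ≢i w zero)

    σm₁≢β : σ (inj₂ m₁) ≢ β
    σm₁≢β = off-w (punchInᵢ≢i w (suc zero))

    centre₁ : ∃ λ u → σ (inj₁ u) ≢ β
    centre₁ with neighbour T₁ conn₁ p
    ... | u , pu = u , proper₁ pu ∘ sym

    u : Fin (3 + s)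
    u = proj₁ centre₁

    only-u : ∀ {i} → σ (inj₁ i) ≢ β → i ≡ u
    only-u {i} σi≢β with i ≟ u
    ... | yes i≡u = i≡u
    ... | no  i≢u = ⊥-elim (no-two-pairs i≢u m₀≢m₁ (≢⇒≡ σi≢β (proj₂ centre₁))
                              (≢⇒≡ σm₀≢β σi≢β) (≢⇒≡ σm₁≢β σi≢β))

    off-u : ∀ {i} → i ≢ u → σ (inj₁ i) ≡ β
    off-u {i} i≢u with σ (inj₁ i) ≟ᵇ β
    ... | yes eq = eq
    ... | no  ≢β = contradiction (only-u ≢β) i≢u

    -- A vertex other than `u` lies on side `β` and its neighbour opposite, so that neighbour is
    -- `u`: the tree is a star.
    to-u : ∀ {i} → i ≢ u → Adj T₁ i u
    to-u {i} i≢u with neighbour T₁ conn₁ i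
    ... | l , il = subst (Adj T₁ i) (only-u λ σl≡β → proper₁ il (trans (off-u i≢u) (sym σl≡β))) il

    to-w : ∀ {j} → j ≢ w → Adj T₂ j w
    to-w {j} j≢w with neighbour T₂ conn₂ j
    ... | m , jm = subst (Adj T₂ j) (only-w (≢⇒≡ (proper₂ jm ∘ sym) (off-w j≢w ∘ sym))) jm

    -- With `w` in the place of `u`, all the chosen vertices lie on side `β`; the counterpart
    -- `Swapped₂` lies opposite.
    data Swapped₁ : Fin (3 + s) → V → Set where
      hub  : Swapped₁ u (inj₂ w)
      rest : ∀ {i} → i ≢ u → Swapped₁ i (inj₁ i)

    data Swapped₂ : Fin (3 + t) → V → Set where
      hub  : Swapped₂ w (inj₁ u)
      rest : ∀ {j} → j ≢ w → Swapped₂ j (inj₂ j)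

    swap₁ : ∀ i → ∃ (Swapped₁ i)
    swap₁ i with i ≟ u
    ... | yes refl = inj₂ w , hub
    ... | no  i≢u  = inj₁ i , rest i≢u

    swap₂ : ∀ j → ∃ (Swapped₂ j)
    swap₂ j with j ≟ w
    ... | yes refl = inj₁ u , hub
    ... | no  j≢w  = inj₂ j , rest j≢w

    injective₁ : ∀ {i l v} → Swapped₁ i v → Swapped₁ l v → i ≡ l
    injective₁ hub      hub      = refl
    injective₁ (rest _) (rest _) = refl

    injective₂ : ∀ {j m v} → Swapped₂ j v → Swapped₂ m v → j ≡ m
    injective₂ hub      hub      = refl
    injective₂ (rest _) (rest _) = refl

    disjoint : ∀ {i j v} → Swapped₁ i v → ¬ Swapped₂ j v
    disjoint hub         (rest j≢w) = j≢w refl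
    disjoint (rest i≢u)  hub        = i≢u refl

    complete : ∀ {i j v x} → Swapped₁ i v → Swapped₂ j x → H v x
    complete hub        hub        = _
    complete hub        (rest j≢w) = Adj-sym T₂ (to-w j≢w)
    complete (rest i≢u) hub        = to-u i≢u
    complete (rest i≢u) (rest j≢w) = _

    spoke₁ : ∀ {i v x} → i ≢ u → Swapped₁ i v → Swapped₁ u x → R v x
    spoke₁ i≢u hub      _          = contradiction refl i≢u
    spoke₁ i≢u (rest _) (rest u≢u) = contradiction refl u≢u
    spoke₁ i≢u (rest _) hub        = same-side _ (trans (off-u i≢u) (sym (proj₂ centre₂)))

    spoke₂ : ∀ {j v x} → j ≢ w → Swapped₂ j v → Swapped₂ w x → R v x
    spoke₂ j≢w hub      _          = contradiction refl j≢w
    spoke₂ j≢w (rest _) (rest w≢w) = contradiction refl w≢w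
    spoke₂ j≢w (rest _) hub        = same-side _ (≢⇒≡ (off-w j≢w) (proj₂ centre₁))

    conclude : K⁻ (3 + s) (3 + t) ⊑ C
    conclude = finish (proj₁ ∘ swap₁) (proj₁ ∘ swap₂)
      (linked-by-hub
        (λ {i} {l} eq → injective₁ (proj₂ (swap₁ i)) (subst (Swapped₁ l) (sym eq) (proj₂ (swap₁ l)))) u
        (λ i i≢u → spoke₁ i≢u (proj₂ (swap₁ i)) (proj₂ (swap₁ u))))
      (linked-by-hub
        (λ {j} {m} eq → injective₂ (proj₂ (swap₂ j)) (subst (Swapped₂ m) (sym eq) (proj₂ (swap₂ m)))) w
        (λ j j≢w → spoke₂ j≢w (proj₂ (swap₂ j)) (proj₂ (swap₂ w))))
      (λ i j eq → disjoint (proj₂ (swap₁ i)) (subst (Swapped₂ j) (sym eq) (proj₂ (swap₂ j))))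
      (λ i j → complete (proj₂ (swap₁ i)) (proj₂ (swap₂ j)))

  K⁻⊑C : K⁻ (3 + s) (3 + t) ⊑ C
  K⁻⊑C with any? (λ i → any? λ l → T? (adj T₁ i l) ×-dec (σ (inj₁ i) ≟ᵇ σ (inj₁ l)))
          | any? (λ j → any? λ m → T? (adj T₂ j m) ×-dec (σ (inj₂ j) ≟ᵇ σ (inj₂ m)))
  ... | yes (_ , _ , il , σ≡) | _ = monochromatic₁ il σ≡
  ... | no _ | yes (_ , _ , jm , σ≡) = monochromatic₂ jm σ≡
  ... | no none₁ | no none₂ =
    Proper.conclude (λ il σ≡ → none₁ (_ , _ , il , σ≡)) (λ jm σ≡ → none₂ (_ , _ , jm , σ≡))

-- Passing to the extremal numbers.

largest-≤ : ∀ {P : ℕ → Set} (P? : ∀ m → Dec (P m)) B →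
  (∀ m → P m → m ≤ B) → ∀ b → largest P? b ≤ B
largest-≤ P? B = largest-elim (_≤ B) P? z≤n

rainbow-free-colouring : ∀ {s t n} (T₁ : Graph s) (T₂ : Graph t) → Connected T₁ → Connected T₂ →
  3 ≤ s → 3 ≤ t → 2 ≤ n → (G : Graph n) → ¬ (K⁻ s t ⊑ G) →
  ∃ λ k → edges G ≤ 2 * k × RainbowFreeWithColours n (join T₁ T₂) k
rainbow-free-colouring {suc (suc (suc s))} {suc (suc (suc t))} {suc (suc m)} T₁ T₂ conn₁ conn₂
  (s≤s (s≤s (s≤s _))) (s≤s (s≤s (s≤s _))) (s≤s (s≤s _)) G free with large-cut (adj G)
... | side , half = size , edges≤ , minColouring , not-rainbow
  where
  C : Graph (2 + m)
  C = cutGraph G side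

  open MinColouring C

  edges≤ : edges G ≤ 2 * size
  edges≤ = begin
    edges G             ≡⟨ edges-pairs G ⟩
    pairs (adj G)       ≤⟨ half ⟩
    2 * pairs (adj C)   ≡⟨ cong (2 *_) (edges-pairs C) ⟨
    2 * edges C         ≤⟨ *-monoʳ-≤ 2 edges≤size ⟩
    2 * size            ∎
    where open ≤-Reasoning

  not-rainbow : ¬ RainbowCopy minColouring (join T₁ T₂)
  not-rainbow (g , g-inj , rainbow) = free (h , h-inj , λ u v uv → proj₁ (T-∧⁻ (h-hom u v uv)))
    where
    back : ∀ p → splitAt (3 + s) (Fin.join (3 + s) (3 + t) p) ≡ p
    back = splitAt-join (3 + s) (3 + t)

    glue : Fin (3 + s) ⊎ Fin (3 + t) → Fin (3 + s + (3 + t))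
    glue = Fin.join (3 + s) (3 + t)

    glue-inj : Injective _≡_ _≡_ glue
    glue-inj {p} {q} eq = trans (sym (back p)) (trans (cong (splitAt (3 + s)) eq) (back q))

    glued : ∀ {p q} → T (joinAdj T₁ T₂ p q) → Adj (join T₁ T₂) (glue p) (glue q)
    glued {p} {q} = subst T (sym (cong₂ (joinAdj T₁ T₂) (back p) (back q)))

    up : ∀ {p q r} → T (joinAdj T₁ T₂ p q) → T (joinAdj T₁ T₂ p r) →
      ¬ Adj C (g (glue p)) (g (glue q)) → ¬ Adj C (g (glue p)) (g (glue r)) →
      g (glue p) Fin.< g (glue q) → g (glue p) Fin.< g (glue r) → q ≡ r
    up {p} {q} {r} pq pr ¬pq ¬pr p<q p<r with rainbow (glue p) (glue q) (glue p) (glue r)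
      (glued {p} {q} pq) (glued {p} {r} pr) (nonedges-same-colour p<q p<r ¬pq ¬pr)
    ... | inj₁ (_ , q≡r)   = glue-inj q≡r
    -- If the two edges match in reverse, then `glue q`, `glue p` and `glue r` all coincide.
    ... | inj₂ (p≡r , q≡p) = glue-inj (trans q≡p p≡r)

    found : K⁻ (3 + s) (3 + t) ⊑ C
    found = CopyOutside.K⁻⊑C T₁ T₂ conn₁ conn₂ C side
      (λ {i} {j} ij → xor⇒≢ (proj₂ (T-∧⁻ {adj G i j} ij))) (g ∘ glue) (glue-inj ∘ g-inj) (λ {p} → up {p})

    h = proj₁ found
    h-inj = proj₁ (proj₂ found)
    h-hom = proj₂ (proj₂ found)

ar⋆-lower : ∀ {s t} (T₁ : Graph s) (T₂ : Graph t) → Connected T₁ → Connected T₂ →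
  3 ≤ s → 3 ≤ t → ∀ n → 2 ≤ n → ex n (K⁻ s t) ≤ 2 * ar⋆ n (join T₁ T₂)
ar⋆-lower {s} {t} T₁ T₂ conn₁ conn₂ 3≤s 3≤t n 2≤n =
  largest-≤ (hFreeWithEdges? n (K⁻ s t)) (2 * ar⋆ n (join T₁ T₂)) attained (n * n)
  where
  attained : ∀ e → HFreeWithEdges n (K⁻ s t) e → e ≤ 2 * ar⋆ n (join T₁ T₂)
  attained e (G , edges≡e , free) =
    let k , edges≤2k , χ = rainbow-free-colouring T₁ T₂ conn₁ conn₂ 3≤s 3≤t 2≤n G free
    in ≤-trans (subst (_≤ 2 * k) edges≡e edges≤2k)
         -- The colouring at hand shows that rainbow-free colourings exist, so `ar⋆` is a true
         -- maximum and not the default 0.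
         (*-monoʳ-≤ 2 {k} {ar⋆ n (join T₁ T₂)} (proj₂ (ar⋆-isMaximum n (join T₁ T₂) (k , χ)) k χ))

-- Fractions are cleared: the first bound is doubled, and the second is raised to the power `s`,
-- turning `n ^ (2 − 1/s)` into `n ^ (2 * s ∸ 1)`.
theorem1p8 : ∀ (s t : ℕ) → 3 ≤ s → s ≤ t →
    ∃ λ (c : ℕ) →
    ∀ (T₁ : Graph s) (T₂ : Graph t) → IsTree T₁ → IsTree T₂ →
    ∀ (n : ℕ) → s + t ≤ n →
    (ex n (K⁻ s t) ≤ 2 * ar⋆ n (join T₁ T₂))
    × (ar⋆ n (join T₁ T₂) ^ s ≤ c ^ s * n ^ (2 * s ∸ 1))
theorem1p8 s t 3≤s s≤t = constant s t ,
  λ T₁ T₂ (conn₁ , acyclic₁) (conn₂ , acyclic₂) n s+t≤n →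
    let 3≤n = ≤-trans 3≤s (≤-trans (m≤m+n s t) s+t≤n)
    in ar⋆-lower T₁ T₂ conn₁ conn₂ 3≤s (≤-trans 3≤s s≤t) n (≤-trans (n≤1+n 2) 3≤n)
     , ar⋆-upper T₁ T₂ acyclic₁ acyclic₂ (≤-trans (s≤s z≤n) 3≤s) n (≤-trans (s≤s z≤n) 3≤n)
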